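{- The minimum integer $k\ge 1$ such that every three-dimensional grid graph is a $k$-interval-PCG is exactly $2$.
   Context: All graphs are finite, simple, undirected, with nonempty vertex set. A weighted tree is a finite tree with strictly positive real edge weights. For a weighted tree $T$ and vertices $x,y$ of $T$, $d_T(x,y)$ is the total weight of the unique $x$–$y$ path, and $L(T)$ is the set of leaves of $T$ (the vertex of a one-vertex tree counts as a leaf). A three-dimensional grid graph is a graph $P_{n_1}\square P_{n_2}\square P_{n_3}$ with $n_1,n_2,n_3$ positive integers: its vertex set is $\{(x_1,x_2,x_3)\in\mathbb{Z}^3: 0\le x_i\le n_i-1 \text{ for } i=1,2,3\}$, and two vertices are adjacent if and only if they differ by $1$ in exactly one coordinate and agree in every other coordinate. $k$-interval-PCG ($k\ge 1$): a graph $G=(V,E)$ is a $k$-interval-PCG if there exist a weighted tree $T$, a bijection $\zeta:V\to L(T)$, and pairwise disjoint closed intervals $I_1,\ldots,I_k$ such that for every pair of distinct vertices $u,v\in V$, $uv\in E$ if and only if $d_T(\zeta(u),\zeta(v))\in\bigcup_{j=1}^k I_j$. -}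

module Defs where

open import Data.Fin.Base using (Fin; toℕ)
open import Data.Fin.Properties using (*↔×) renaming (_≟_ to _≟ᶠ_)
open import Data.List.Base using (List; []; _∷_; length)
open import Data.List.Relation.Unary.Unique.Propositional using (Unique)
open import Data.Nat.Base as ℕ using (ℕ; suc; NonZero)
import Data.Nat.Properties as ℕ
open import Data.Product using (_×_; _,_; ∃-syntax; ∃!)
open import Data.Product.Function.NonDependent.Propositional using (_×-↔_)
open import Data.Rational as ℚ using (ℚ; 0ℚ; ½; ∣_∣)
import Data.Rational.Properties as ℚ
open import Data.Rational.Solver using (module +-*-Solver)
open import Data.Sum.Base using (_⊎_; inj₁; inj₂)
open import Function.Bundles using (_↔_; _⇔_)
open import Function.Construct.Composition using (_↔-∘_)
open import Function.Construct.Identity using (↔-id)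
open import Function.Construct.Symmetry using (↔-sym)
open import Function.Definitions using (Injective)
open import Relation.Binary.Construct.Closure.ReflexiveTransitive using (Star; ε; _◅_)
open import Relation.Binary.Core using (Rel)
open import Relation.Binary.Definitions using (Decidable; Symmetric; Irreflexive)
open import Relation.Binary.PropositionalEquality
  using (_≡_; _≢_; refl; sym; trans; cong)
open import Relation.Nullary using (¬_)
open import Relation.Nullary.Decidable using (_×-dec_; _⊎-dec_)
open import Level using (0ℓ)

------------------------------------------------------------------------
-- Real numbers, as Cauchy sequences of rationals. Two sequences denote the
-- same real when they are related by _≃ᴿ_; every notion below respects it.

IsCauchy : (ℕ → ℚ) → Set
IsCauchy s = ∀ δ → 0ℚ ℚ.< δ →
  ∃[ N ] (∀ m n → N ℕ.≤ m → N ℕ.≤ n → ∣ s m ℚ.- s n ∣ ℚ.≤ δ)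

record ℝ : Set where
  constructor mkℝ
  field
    seq    : ℕ → ℚ
    cauchy : IsCauchy seq

open ℝ public

infix  4 _<ᴿ_ _≤ᴿ_ _≃ᴿ_
infixl 6 _+ᴿ_

-- Eventually separated by a fixed positive rational.
_<ᴿ_ : Rel ℝ 0ℓ
x <ᴿ y = ∃[ δ ] (0ℚ ℚ.< δ × ∃[ N ] (∀ n → N ℕ.≤ n → seq x n ℚ.+ δ ℚ.≤ seq y n))

-- Defined negatively, so that it is stable under double negation.
_≤ᴿ_ : Rel ℝ 0ℓ
x ≤ᴿ y = ¬ (y <ᴿ x)

_≃ᴿ_ : Rel ℝ 0ℓ
x ≃ᴿ y = x ≤ᴿ y × y ≤ᴿ x

0ᴿ : ℝ
0ᴿ = mkℝ (λ _ → 0ℚ) λ _ 0<δ → 0 , λ _ _ _ _ → ℚ.<⇒≤ 0<δ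

private
  interchange : ∀ a b c d →
    (a ℚ.+ b) ℚ.- (c ℚ.+ d) ≡ (a ℚ.- c) ℚ.+ (b ℚ.- d)
  interchange = solve 4 (λ a b c d →
    (a :+ b) :- (c :+ d) := (a :- c) :+ (b :- d)) refl
    where open +-*-Solver

  halves : ∀ δ → ½ ℚ.* δ ℚ.+ ½ ℚ.* δ ≡ δ
  halves δ = trans (sym (ℚ.*-distribʳ-+ δ ½ ½)) (ℚ.*-identityˡ δ)

  0<half : ∀ δ → 0ℚ ℚ.< δ → 0ℚ ℚ.< ½ ℚ.* δ
  0<half δ 0<δ = ℚ.*-monoʳ-<-pos ½ 0<δ

+-cauchy : ∀ {s t} → IsCauchy s → IsCauchy t → IsCauchy (λ n → s n ℚ.+ t n)
+-cauchy {s} {t} cs ct δ 0<δ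
  with cs (½ ℚ.* δ) (0<half δ 0<δ) | ct (½ ℚ.* δ) (0<half δ 0<δ)
... | M , hM | N , hN = M ℕ.⊔ N , bound
  where
  open ℚ.≤-Reasoning
  bound : ∀ m n → M ℕ.⊔ N ℕ.≤ m → M ℕ.⊔ N ℕ.≤ n →
          ∣ (s m ℚ.+ t m) ℚ.- (s n ℚ.+ t n) ∣ ℚ.≤ δ
  bound m n m≥ n≥ = begin
    ∣ (s m ℚ.+ t m) ℚ.- (s n ℚ.+ t n) ∣
      ≡⟨ cong ∣_∣ (interchange (s m) (t m) (s n) (t n)) ⟩
    ∣ (s m ℚ.- s n) ℚ.+ (t m ℚ.- t n) ∣
      ≤⟨ ℚ.∣p+q∣≤∣p∣+∣q∣ (s m ℚ.- s n) (t m ℚ.- t n) ⟩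
    ∣ s m ℚ.- s n ∣ ℚ.+ ∣ t m ℚ.- t n ∣
      ≤⟨ ℚ.+-mono-≤
           (hM m n (ℕ.m⊔n≤o⇒m≤o M N m≥) (ℕ.m⊔n≤o⇒m≤o M N n≥))
           (hN m n (ℕ.m⊔n≤o⇒n≤o M N m≥) (ℕ.m⊔n≤o⇒n≤o M N n≥)) ⟩
    ½ ℚ.* δ ℚ.+ ½ ℚ.* δ
      ≡⟨ halves δ ⟩
    δ ∎

_+ᴿ_ : ℝ → ℝ → ℝ
x +ᴿ y = mkℝ (λ n → seq x n ℚ.+ seq y n) (+-cauchy {seq x} {seq y} (cauchy x) (cauchy y))

------------------------------------------------------------------------
-- Finite simple graphs with nonempty vertex set

record Graph : Set₁ where
  field
    V        : Set
    order    : ℕ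
    finite   : V ↔ Fin order
    nonEmpty : V
    Adj      : Rel V 0ℓ
    adj?     : Decidable Adj
    symm     : Symmetric Adj
    irrefl   : Irreflexive _≡_ Adj

module _ (G : Graph) where
  open Graph G

  Walk : Rel V 0ℓ
  Walk = Star Adj

  vertices : ∀ {x y} → Walk x y → List V
  vertices {x} ε       = x ∷ []
  vertices {x} (_ ◅ p) = x ∷ vertices p

  record Path (x y : V) : Set where
    constructor path
    field
      walk     : Walk x y
      distinct : Unique (vertices walk)

  Connected : Set
  Connected = ∀ x y → Path x y

  -- A cycle is a path on at least three vertices whose ends are adjacent.
  Acyclic : Set
  Acyclic = ∀ {x y} (p : Path x y) →
    3 ℕ.≤ length (vertices (Path.walk p)) → ¬ Adj y x

  Leaf : V → Set
  Leaf x = ∃! _≡_ (Adj x) ⊎ (∀ y → y ≡ x)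

------------------------------------------------------------------------
-- Weighted trees

record WeightedTree : Set₁ where
  field
    graph     : Graph
    connected : Connected graph
    acyclic   : Acyclic graph

  open Graph graph public

  -- Only the values of weight on adjacent pairs are meaningful.
  field
    weight     : V → V → ℝ
    weight-sym : ∀ {x y} → Adj x y → weight x y ≃ᴿ weight y x
    weight-pos : ∀ {x y} → Adj x y → 0ᴿ <ᴿ weight x y

  totalWeight : ∀ {x y} → Walk graph x y → ℝ
  totalWeight ε                 = 0ᴿ
  totalWeight (_◅_ {x} {y} _ p) = weight x y +ᴿ totalWeight p

  -- By acyclicity, the path supplied by connected is the only one.
  dist : V → V → ℝ
  dist x y = totalWeight (Path.walk (connected x y))

------------------------------------------------------------------------
-- k-interval pairwise compatibility graphs

record ClosedInterval : Set where
  field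
    lo hi : ℝ
    lo≤hi : lo ≤ᴿ hi

infix 4 _∈ᴵ_

_∈ᴵ_ : ℝ → ClosedInterval → Set
r ∈ᴵ I = lo ≤ᴿ r × r ≤ᴿ hi
  where open ClosedInterval I

Disjoint : Rel ClosedInterval 0ℓ
Disjoint I J = ¬ (∃[ r ] (r ∈ᴵ I × r ∈ᴵ J))

record IsIntervalPCG (k : ℕ) (G : Graph) : Set₁ where
  open Graph G using (V; Adj)
  field
    tree : WeightedTree

  private module T = WeightedTree tree

  -- ζ is injective with image exactly the leaves: a bijection V → L(T).
  field
    ζ           : V → T.V
    ζ-injective : Injective _≡_ _≡_ ζ
    ζ-image     : ∀ x → Leaf T.graph x ⇔ (∃[ v ] ζ v ≡ x)
    interval    : Fin k → ClosedInterval
    disjoint    : ∀ {i j} → i ≢ j → Disjoint (interval i) (interval j)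
    adj⇔        : ∀ {u v} → u ≢ v →
                  Adj u v ⇔ (∃[ j ] T.dist (ζ u) (ζ v) ∈ᴵ interval j)

------------------------------------------------------------------------
-- Three-dimensional grids

DifferByOne : ∀ {n} → Rel (Fin n) 0ℓ
DifferByOne i j = ℕ.∣ toℕ i - toℕ j ∣ ≡ 1

private
  differ? : ∀ {n} → Decidable (DifferByOne {n})
  differ? i j = ℕ.∣ toℕ i - toℕ j ∣ ℕ.≟ 1

  differ-sym : ∀ {n} → Symmetric (DifferByOne {n})
  differ-sym {_} {i} {j} e = trans (ℕ.∣-∣-comm (toℕ j) (toℕ i)) e

  differ-irrefl : ∀ {n} (i : Fin n) → ¬ DifferByOne i i
  differ-irrefl i e with () ← trans (sym (ℕ.∣n-n∣≡0 (toℕ i))) e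

module _ (n₁ n₂ n₃ : ℕ) where

  GridVertex : Set
  GridVertex = Fin n₁ × Fin n₂ × Fin n₃

  GridAdj : Rel GridVertex 0ℓ
  GridAdj (x₁ , x₂ , x₃) (y₁ , y₂ , y₃) =
      (DifferByOne x₁ y₁ × x₂ ≡ y₂ × x₃ ≡ y₃)
    ⊎ (x₁ ≡ y₁ × DifferByOne x₂ y₂ × x₃ ≡ y₃)
    ⊎ (x₁ ≡ y₁ × x₂ ≡ y₂ × DifferByOne x₃ y₃)

  gridAdj? : Decidable GridAdj
  gridAdj? (x₁ , x₂ , x₃) (y₁ , y₂ , y₃) =
    (differ? x₁ y₁ ×-dec x₂ ≟ᶠ y₂ ×-dec x₃ ≟ᶠ y₃)
    ⊎-dec (x₁ ≟ᶠ y₁ ×-dec differ? x₂ y₂ ×-dec x₃ ≟ᶠ y₃)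
    ⊎-dec (x₁ ≟ᶠ y₁ ×-dec x₂ ≟ᶠ y₂ ×-dec differ? x₃ y₃)

  gridSym : Symmetric GridAdj
  gridSym {x₁ , _} {y₁ , _} (inj₁ (d , e , f)) =
    inj₁ (differ-sym {x = x₁} {y₁} d , sym e , sym f)
  gridSym {_ , x₂ , _} {_ , y₂ , _} (inj₂ (inj₁ (d , e , f))) =
    inj₂ (inj₁ (sym d , differ-sym {x = x₂} {y₂} e , sym f))
  gridSym {_ , _ , x₃} {_ , _ , y₃} (inj₂ (inj₂ (d , e , f))) =
    inj₂ (inj₂ (sym d , sym e , differ-sym {x = x₃} {y₃} f))

  gridIrrefl : Irreflexive _≡_ GridAdj
  gridIrrefl {x₁ , _}     refl (inj₁ (d , _))            = differ-irrefl x₁ d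
  gridIrrefl {_ , x₂ , _} refl (inj₂ (inj₁ (_ , d , _))) = differ-irrefl x₂ d
  gridIrrefl {_ , _ , x₃} refl (inj₂ (inj₂ (_ , _ , d))) = differ-irrefl x₃ d

private
  first : ∀ n → .{{NonZero n}} → Fin n
  first (suc _) = Fin.zero

Grid : (n₁ n₂ n₃ : ℕ) → .{{NonZero n₁}} → .{{NonZero n₂}} → .{{NonZero n₃}} → Graph
Grid n₁ n₂ n₃ = record
  { V        = GridVertex n₁ n₂ n₃
  ; order    = n₁ ℕ.* (n₂ ℕ.* n₃)
  ; finite   = ↔-sym *↔× ↔-∘ (↔-id _ ×-↔ ↔-sym *↔×)
  ; nonEmpty = first n₁ , first n₂ , first n₃
  ; Adj      = GridAdj n₁ n₂ n₃
  ; adj?     = gridAdj? n₁ n₂ n₃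
  ; symm     = gridSym n₁ n₂ n₃
  ; irrefl   = gridIrrefl n₁ n₂ n₃
  }

------------------------------------------------------------------------

IsMinimum : ∀ {ℓ} → (ℕ → Set ℓ) → ℕ → Set ℓ
IsMinimum P m = P m × (∀ k → P k → m ℕ.≤ k)

{-# OPTIONS --safe #-}

-- Lower bound. Suppose an adjacency is recorded by one interval, so that every
-- non-adjacent pair of the 3 × 3 × 3 grid is either long (distance above the
-- interval) or short (below it). Tree distances satisfy the four-point condition,
-- hence for vertices e₁, e₂, e₃, o₁, o₂, o₃ the sum d(e₁,o₁) + d(e₂,o₂) + d(e₃,o₃)
-- is never the strict maximum of the six sums over permutations. This forbids many
-- patterns of long and short pairs (the admissible hexads), and unit propagation
-- shows that no long/short pattern avoids all of them.
--
-- Upper bound. Hang the vertices of the grid from a long path: u = (x, y, z) at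
-- position K (x + y + z), plus 1 if this sum is odd, with pendant weight
-- C₀ + M (z − x − y) + 4 x for even and C₁ − M (z − x − y) − 4 x for odd u, where
-- C₀ ≫ C₁ ≫ M ≫ K ≫ 1. If u is even, v is odd and u − v = (a, b, c), their distance is
-- C₀ + C₁ + M (c − a − b) + 4 a + |K (a + b + c) − 1|. It lies within 2 of
-- C₀ + C₁ + s M + K − s for s = 1 or s = −1 exactly if (a, b, c) is ± a unit vector,
-- whereas for equal parities the distance is far away from both numbers.
module Submission where

open import Defs
open import Data.Bool.Base using (Bool; true; false; T; not; _∧_; _∨_)
open import Data.Bool.Properties using (T-∧; T-∨; T?; not-¬)
open import Data.Empty using (⊥; ⊥-elim)
open import Data.Fin.Base as Fin using (Fin; toℕ; fromℕ; fromℕ<; opposite)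
open import Data.Fin.Patterns
open import Data.Fin.Properties
  using (toℕ-injective; toℕ-fromℕ<; toℕ-fromℕ; toℕ<n; toℕ≤pred[n]; +↔⊎; inj⇒≟; opposite-involutive)
  renaming (_≟_ to _≟ᶠ_)
open import Data.Integer.Base as ℤ using (ℤ; +_; 0ℤ; 1ℤ)
import Data.Integer.Properties as ℤ
open import Data.Integer.Solver renaming (module +-*-Solver to ℤ-Solver)
open import Data.List.Base using (List; []; _∷_; _∷ʳ_; length; map; concat)
open import Data.List.Membership.Propositional using (_∈_; _∉_)
open import Data.List.Relation.Unary.All as All using (All; []; _∷_)
import Data.List.Relation.Unary.All.Properties as All
open import Data.List.Relation.Unary.AllPairs using ([]; _∷_)
open import Data.List.Relation.Unary.Any using (here; there)
open import Data.List.Relation.Unary.Unique.Propositional using (Unique)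
open import Data.Nat.Base as ℕ using (ℕ; zero; suc; NonZero; s≤s; z≤n)
import Data.Nat.Coprimality as Coprime
open import Data.Nat.DivMod using (_/_; _%_)
import Data.Nat.Properties as ℕ
open import Data.Product using (_×_; _,_; proj₁; proj₂; Σ-syntax; ∃-syntax)
open import Data.Product.Properties using (≡-dec)
open import Data.Rational as ℚ using (ℚ; mkℚ; 0ℚ; ½; *≤*)
import Data.Rational.Properties as ℚ
open import Data.Rational.Solver renaming (module +-*-Solver to ℚ-Solver)
open import Data.Rational.Unnormalised.Base using (*≡*)
import Data.Rational.Unnormalised.Properties as ℚᵘ
open import Data.Sum.Base as Sum using (_⊎_; inj₁; inj₂)
open import Data.Sum.Function.Propositional using (_⊎-↔_)
open import Data.Sum.Properties using (inj₂-injective)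
open import Data.Unit.Base using (tt)
open import Function.Base using (_∘_)
open import Function.Bundles using (_↔_; _⇔_; mk⇔; Inverse; Equivalence)
open import Function.Construct.Composition using (_↔-∘_)
open import Function.Construct.Identity using (↔-id)
open import Function.Construct.Symmetry using (↔-sym)
open import Function.Properties.Inverse using (↔⇒↣)
open import Relation.Binary.Construct.Closure.ReflexiveTransitive using (ε; _◅_)
open import Relation.Binary.Definitions
  using (Decidable; DecidableEquality; Irreflexive; Symmetric; tri<; tri≈; tri>)
open import Relation.Binary.PropositionalEquality
open import Relation.Nullary using (¬_; Dec; yes; no; does)
open import Relation.Nullary.Decidable using (¬?; _×-dec_; does-⇔)

-- Real numbers

-- Lower bound: the order on reals is undecidable and `weight` is symmetric only up to `_≃ᴿ_`, so
-- all estimates are made at one late index of the Cauchy sequences, where finitely many strict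
-- inequalities hold together and the tree carries a rational metric. The long/short pattern is
-- available only under a double negation, which suffices because the goal is `⊥`. Every edge joins
-- vertices of opposite parity; taking the `eᵢ` even and the `oᵢ` odd, the search never meets a pair
-- of equal parity.
--
-- Upper bound: put s = c - a - b and t = a + b + c, which M and K force to be ± 1. For t = s a unit
-- vector needs a = 0, for t = -s it needs a = 0 or a = -s. The spine shows only |K t - 1|; without
-- the parity shift t and -t would look alike, and a = -s with t = s could not be rejected. With it,
-- 4 a + |K t - 1| = 4 a + K - t takes the values K - s for t = s and K + s, K - 3 s for t = -s, all
-- within 2 of K - s, while every other a lands at least 4 away from K - s. This fixes the
-- coefficient 4, the centres and the radius.

module _ where
  open ℚ-Solver

  -- Transfers an inequality along equal differences, so that a linear combination of hypotheses
  -- leaves only a ring identity for the solver.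
  ≤-by : ∀ {a b c d} → a ℚ.≤ b → b ℚ.- a ≡ d ℚ.- c → c ℚ.≤ d
  ≤-by {a} {b} {c} {d} a≤b eq = subst₂ ℚ._≤_
    (solve 2 (λ a c → a :+ (c :- a) := c) refl a c)
    (trans (solve 3 (λ a b c → b :+ (c :- a) := (b :- a) :+ c) refl a b c)
      (trans (cong (ℚ._+ c) eq) (solve 2 (λ c d → (d :- c) :+ c := d) refl c d)))
    (ℚ.+-monoˡ-≤ (c ℚ.- a) a≤b)

  <-by : ∀ {a b c d} → a ℚ.< b → b ℚ.- a ≡ d ℚ.- c → c ℚ.< d
  <-by {a} {b} {c} {d} a<b eq = subst₂ ℚ._<_
    (solve 2 (λ a c → a :+ (c :- a) := c) refl a c)
    (trans (solve 3 (λ a b c → b :+ (c :- a) := (b :- a) :+ c) refl a b c)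
      (trans (cong (ℚ._+ c) eq) (solve 2 (λ c d → (d :- c) :+ c := d) refl c d)))
    (ℚ.+-monoˡ-< (c ℚ.- a) a<b)

-- The strict inequalities that an argument needs hold together from some index on; `ev-extract`
-- then fixes one index, and what follows is about rationals.
Eventually : (ℕ → Set) → Set
Eventually P = ∃[ N ] (∀ n → N ℕ.≤ n → P n)

ev-map : ∀ {P Q : ℕ → Set} → (∀ {n} → P n → Q n) → Eventually P → Eventually Q
ev-map f (N , p) = N , λ n N≤n → f (p n N≤n)

ev-zip : ∀ {P Q R : ℕ → Set} → (∀ {n} → P n → Q n → R n) →
  Eventually P → Eventually Q → Eventually R
ev-zip f (M , p) (N , q) = M ℕ.⊔ N , λ n le →
  f (p n (ℕ.m⊔n≤o⇒m≤o M N le)) (q n (ℕ.m⊔n≤o⇒n≤o M N le))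

ev-Fin : ∀ {k} {P : Fin k → ℕ → Set} → (∀ i → Eventually (P i)) → Eventually (λ n → ∀ i → P i n)
ev-Fin {ℕ.zero}  h = 0 , λ _ _ ()
ev-Fin {ℕ.suc k} h = ev-zip (λ { p q Fin.zero → p ; p q (Fin.suc i) → q i }) (h Fin.zero) (ev-Fin (h ∘ Fin.suc))

ev-finite : ∀ {A : Set} {k} {P : A → ℕ → Set} → A ↔ Fin k →
  (∀ x → Eventually (P x)) → Eventually (λ n → ∀ x → P x n)
ev-finite {P = P} A↔ h = ev-map
  (λ {n} p x → subst (λ y → P y n) (Inverse.strictlyInverseʳ A↔ x) (p (Inverse.to A↔ x)))
  (ev-Fin (h ∘ Inverse.from A↔))

ev-extract : ∀ {P : ℕ → Set} → Eventually P → ∃[ n ] P n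
ev-extract (N , p) = N , p N ℕ.≤-refl

infix 4 _≲_
-- A positive form of `_≤ᴿ_`. The negation yields no index at which to compare, whereas these bounds
-- can be added and composed, the slack `q` being divided among them.
_≲_ : ℝ → ℝ → Set
x ≲ y = ∀ q → 0ℚ ℚ.< q → Eventually (λ n → seq x n ℚ.≤ seq y n ℚ.+ q)

<⇒≱ : ∀ {p q} → p ℚ.< q → ¬ (q ℚ.≤ p)
<⇒≱ p<q q≤p = ℚ.<-irrefl refl (ℚ.<-≤-trans p<q q≤p)

module _ where
  open ℚ-Solver

  ½-pos : ∀ {q} → 0ℚ ℚ.< q → 0ℚ ℚ.< ½ ℚ.* q
  ½-pos = ℚ.*-monoʳ-<-pos ½

  ½-< : ∀ {q} → 0ℚ ℚ.< q → ½ ℚ.* q ℚ.< q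
  ½-< {q} 0<q = <-by (½-pos 0<q) (solve 1 (λ q → con ½ :* q :- con 0ℚ := q :- con ½ :* q) refl q)

  ∣∣≤⇒≤ : ∀ {p q r} → ℚ.∣ p ℚ.- q ∣ ℚ.≤ r → p ℚ.≤ q ℚ.+ r
  ∣∣≤⇒≤ {p} {q} {r} le = ≤-by (ℚ.≤-trans (p≤∣p∣ (p ℚ.- q)) le)
    (solve 3 (λ p q r → r :- (p :- q) := q :+ r :- p) refl p q r)
    where
    p≤∣p∣ : ∀ p → p ℚ.≤ ℚ.∣ p ∣
    p≤∣p∣ p with ℚ.≤-total 0ℚ p
    ... | inj₁ 0≤p = ℚ.≤-reflexive (sym (ℚ.0≤p⇒∣p∣≡p 0≤p))
    ... | inj₂ p≤0 = ℚ.≤-trans p≤0 (ℚ.0≤∣p∣ p)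

  -- One comparison of rationals, at an index `M` beyond which both sequences vary by at most `q`,
  -- decides. If `x` exceeds `y` by `3 q` there, it exceeds it by `q` ever after, against `x ≤ᴿ y`;
  -- otherwise `x` exceeds `y` by at most `5 q` ever after, which is why `q` is a fifth of the
  -- slack.
  ≤ᴿ⇒≲ : ∀ {x y} → x ≤ᴿ y → x ≲ y
  ≤ᴿ⇒≲ {x} {y} x≤y η 0<η = result
    where
    q : ℚ
    q = (+ 1 ℚ./ 5) ℚ.* η

    0<q : 0ℚ ℚ.< q
    0<q = ℚ.*-monoʳ-<-pos (+ 1 ℚ./ 5) 0<η

    close : ∀ z → ∃[ N ] (∀ m n → N ℕ.≤ m → N ℕ.≤ n → ℚ.∣ seq z m ℚ.- seq z n ∣ ℚ.≤ q)
    close z = cauchy z q 0<q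

    M : ℕ
    M = proj₁ (close x) ℕ.⊔ proj₁ (close y)

    near-x : ∀ m n → M ℕ.≤ m → M ℕ.≤ n → seq x m ℚ.≤ seq x n ℚ.+ q
    near-x m n M≤m M≤n = ∣∣≤⇒≤ (proj₂ (close x) m n
      (ℕ.m⊔n≤o⇒m≤o _ (proj₁ (close y)) M≤m) (ℕ.m⊔n≤o⇒m≤o _ (proj₁ (close y)) M≤n))

    near-y : ∀ m n → M ℕ.≤ m → M ℕ.≤ n → seq y m ℚ.≤ seq y n ℚ.+ q
    near-y m n M≤m M≤n = ∣∣≤⇒≤ (proj₂ (close y) m n
      (ℕ.m⊔n≤o⇒n≤o (proj₁ (close x)) _ M≤m) (ℕ.m⊔n≤o⇒n≤o (proj₁ (close x)) _ M≤n))

    result : Eventually (λ n → seq x n ℚ.≤ seq y n ℚ.+ η)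
    result with ℚ.≤-total (seq x M) (seq y M ℚ.+ (q ℚ.+ q ℚ.+ q))
    ... | inj₁ le = M , λ n M≤n → ≤-by
      (ℚ.+-mono-≤ (ℚ.+-mono-≤ le (near-x n M M≤n ℕ.≤-refl)) (near-y M n ℕ.≤-refl M≤n))
      (solve 5 (λ a b c d e → let f = con (+ 1 ℚ./ 5) :* e in
        (a :+ (f :+ f :+ f) :+ (b :+ f) :+ (c :+ f)) :- ((b :+ d) :+ a) := (c :+ e) :- d) refl
        (seq y M) (seq x M) (seq y n) (seq x n) η)
    ... | inj₂ ge = ⊥-elim (x≤y (q , 0<q , M , λ n M≤n → ≤-by
      (ℚ.+-mono-≤ (ℚ.+-mono-≤ ge (near-x M n ℕ.≤-refl M≤n)) (near-y n M M≤n ℕ.≤-refl))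
      (solve 5 (λ a b c d f →
        (b :+ (d :+ f) :+ (a :+ f)) :- ((a :+ (f :+ f :+ f) :+ b) :+ c) := d :- (c :+ f)) refl
        (seq y M) (seq x M) (seq y n) (seq x n) q)))

  ≲⇒≤ᴿ : ∀ {x y} → x ≲ y → x ≤ᴿ y
  ≲⇒≤ᴿ {x} {y} x≲y (δ , 0<δ , y<x) with ev-extract (ev-zip _,_ (x≲y _ (½-pos 0<δ)) y<x)
  ... | n , x≤ , y≤ = <⇒≱ (½-< 0<δ) (≤-by (ℚ.≤-trans y≤ x≤)
    (solve 3 (λ y h d → y :+ h :- (y :+ d) := h :- d) refl (seq y n) (½ ℚ.* δ) δ))

  ≲-pointwise : ∀ {x y} → (∀ n → seq x n ℚ.≤ seq y n) → x ≲ y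
  ≲-pointwise {y = y} h q 0<q = 0 , λ n _ → ℚ.≤-trans (h n)
    (≤-by (ℚ.<⇒≤ 0<q) (solve 2 (λ y q → q :- con 0ℚ := y :+ q :- y) refl (seq y n) q))

  +-mono-≲ : ∀ {x y z w} → x ≲ y → z ≲ w → x +ᴿ z ≲ y +ᴿ w
  +-mono-≲ {x} {y} {z} {w} x≲y z≲w q 0<q = ev-zip
    (λ {n} p r → ≤-by (ℚ.+-mono-≤ p r)
      (solve 4 (λ y w xz q → y :+ con ½ :* q :+ (w :+ con ½ :* q) :- xz := y :+ w :+ q :- xz) refl
        (seq y n) (seq w n) (seq x n ℚ.+ seq z n) q))
    (x≲y _ (½-pos 0<q)) (z≲w _ (½-pos 0<q))

  ≲-trans : ∀ {x y z} → x ≲ y → y ≲ z → x ≲ z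
  ≲-trans {x} {y} {z} x≲y y≲z q 0<q = ev-zip
    (λ {n} p r → ≤-by (ℚ.+-mono-≤ p r)
      (solve 4 (λ x y z q → y :+ con ½ :* q :+ (z :+ con ½ :* q) :- (x :+ y) := z :+ q :- x) refl
        (seq x n) (seq y n) (seq z n) q))
    (x≲y _ (½-pos 0<q)) (y≲z _ (½-pos 0<q))

  ≲-<-trans : ∀ {x y z} → x ≲ y → y <ᴿ z → x <ᴿ z
  ≲-<-trans {x} {y} {z} x≲y (δ , 0<δ , y<z) = _ , ½-pos 0<δ , ev-zip
    (λ {n} p r → ≤-by (ℚ.+-mono-≤ p r)
      (solve 4 (λ x y z d → y :+ con ½ :* d :+ z :- (x :+ (y :+ d)) := z :- (x :+ con ½ :* d)) refl
        (seq x n) (seq y n) (seq z n) δ))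
    (x≲y _ (½-pos 0<δ)) y<z

  <-≲-trans : ∀ {x y z} → x <ᴿ y → y ≲ z → x <ᴿ z
  <-≲-trans {x} {y} {z} (δ , 0<δ , x<y) y≲z = _ , ½-pos 0<δ , ev-zip
    (λ {n} p r → ≤-by (ℚ.+-mono-≤ p r)
      (solve 4 (λ x y z d → z :+ con ½ :* d :+ y :- (y :+ (x :+ d)) := z :- (x :+ con ½ :* d)) refl
        (seq x n) (seq y n) (seq z n) δ))
    (y≲z _ (½-pos 0<δ)) x<y

  +-double-< : ∀ {x y} → x <ᴿ y → x +ᴿ x <ᴿ y +ᴿ y
  +-double-< {x} {y} (δ , 0<δ , N , x<y) = δ ℚ.+ δ , ℚ.+-mono-< 0<δ 0<δ , N , λ n N≤n →
    ≤-by (ℚ.+-mono-≤ (x<y n N≤n) (x<y n N≤n))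
      (solve 3 (λ x y d → y :+ y :- (x :+ d :+ (x :+ d)) := y :+ y :- (x :+ x :+ (d :+ d))) refl
        (seq x n) (seq y n) δ)

  <ᴿ⇒ev : ∀ {x y} → x <ᴿ y → Eventually (λ n → seq x n ℚ.< seq y n)
  <ᴿ⇒ev {x} (δ , 0<δ , x<y) = ev-map
    (λ {n} → ℚ.<-≤-trans (<-by 0<δ (solve 2 (λ x d → d :- con 0ℚ := x :+ d :- x) refl (seq x n) δ))) x<y

≤ᴿ-<-trans : ∀ {x y z} → x ≤ᴿ y → y <ᴿ z → x <ᴿ z
≤ᴿ-<-trans {x} {y} {z} x≤y = ≲-<-trans {x} {y} {z} (≤ᴿ⇒≲ {x} {y} x≤y)

<-≤ᴿ-trans : ∀ {x y z} → x <ᴿ y → y ≤ᴿ z → x <ᴿ z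
<-≤ᴿ-trans {x} {y} {z} x<y y≤z = <-≲-trans {x} {y} {z} x<y (≤ᴿ⇒≲ {y} {z} y≤z)

<ᴿ⇒≤ᴿ : ∀ {x y} → x <ᴿ y → x ≤ᴿ y
<ᴿ⇒≤ᴿ {x} {y} x<y y<x = proj₂ (ev-extract {λ _ → ⊥} (ev-zip (λ {n} → ℚ.<-asym {seq x n} {seq y n})
  (<ᴿ⇒ev {x} {y} x<y) (<ᴿ⇒ev {y} {x} y<x)))

-- Distances in trees

module Paths (G : Graph) where
  open Graph G

  infix 4 _≟_
  _≟_ : DecidableEquality V
  _≟_ = inj⇒≟ (↔⇒↣ finite)

  open import Data.List.Membership.DecPropositional _≟_ public using (_∈?_)

  Distinct : ∀ {x y} → Walk G x y → Set
  Distinct p = Unique (vertices G p)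

  start∈ : ∀ {x y} (p : Walk G x y) → x ∈ vertices G p
  start∈ ε       = here refl
  start∈ (_ ◅ _) = here refl

  end∈ : ∀ {x y} (p : Walk G x y) → y ∈ vertices G p
  end∈ ε       = here refl
  end∈ (_ ◅ p) = there (end∈ p)

  ◅-distinct : ∀ {x y z} (e : Adj x y) (p : Walk G y z) →
    x ∉ vertices G p → Distinct p → Distinct (e ◅ p)
  ◅-distinct e p x∉p u = All.tabulate (λ v∈p x≡v → x∉p (subst (_∈ vertices G p) (sym x≡v) v∈p)) ∷ u

  start∉ : ∀ {x y z} {e : Adj x y} (p : Walk G y z) → Distinct (e ◅ p) → x ∉ vertices G p
  start∉ p (x∉p ∷ _) x∈p = All.lookup x∉p x∈p refl

  prefix : ∀ {x y z} (p : Walk G x y) → Distinct p → z ∈ vertices G p →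
    Σ[ q ∈ Walk G x z ] Distinct q × (∀ {v} → v ∈ vertices G q → v ∈ vertices G p)
  prefix ε       u        (here refl) = ε , [] ∷ [] , λ v∈q → v∈q
  prefix (e ◅ p) u        (here refl) = ε , [] ∷ [] , λ { (here v≡x) → here v≡x }
  prefix (e ◅ p) (x∉ ∷ u) (there z∈p) with prefix p u z∈p
  ... | q , uq , q⊆p = e ◅ q , ◅-distinct e q (λ x∈q → start∉ {e = e} p (x∉ ∷ u) (q⊆p x∈q)) uq ,
    λ { (here v≡x) → here v≡x ; (there v∈q) → there (q⊆p v∈q) }

module Length (G : Graph) (W : Graph.V G → Graph.V G → ℚ) where

  len : ∀ {x y} → Walk G x y → ℚ
  len ε                   = 0ℚ
  len (_◅_ {x} {y} _ p) = W x y ℚ.+ len p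

module Metric (G : Graph) (connected : Connected G) (acyclic : Acyclic G)
  (W : Graph.V G → Graph.V G → ℚ)
  (W-sym : ∀ x y → W x y ≡ W y x)
  (W-nonNeg : ∀ x y → Graph.Adj G x y → 0ℚ ℚ.≤ W x y)
  where
  open Graph G
  open Paths G
  open Length G W
  open ℚ-Solver

  D : V → V → ℚ
  D x y = len (Path.walk (connected x y))

  -- If `z` came later, the part of `p` up to `z` and the edge back to `x` would form a cycle. The
  -- edge is read off `p`, as an adjacency may have several proofs.
  neighbour-second : ∀ {x t z} (p : Walk G x t) → Distinct p → Adj z x → z ∈ vertices G p →
    Σ[ e ∈ Adj x z ] Σ[ q ∈ Walk G z t ] p ≡ e ◅ q
  neighbour-second ε _ a (here refl) = ⊥-elim (irrefl refl a)
  neighbour-second (_ ◅ _) _ a (here refl) = ⊥-elim (irrefl refl a)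
  neighbour-second {z = z} (_◅_ {j = y} e p) (x∉ ∷ u) a (there z∈p) with z ≟ y
  ... | yes refl = e , p , refl
  ... | no z≢y with prefix p u z∈p
  ...   | ε , _ , _ = ⊥-elim (z≢y refl)
  ...   | e′ ◅ q , uq , q⊆p = ⊥-elim (acyclic
    (path (e ◅ e′ ◅ q) (◅-distinct e (e′ ◅ q) (λ x∈q → start∉ {e = e} p (x∉ ∷ u) (q⊆p x∈q)) uq))
    (s≤s (s≤s (nonempty q))) a)
    where
    nonempty : ∀ {v w} (r : Walk G v w) → 1 ℕ.≤ length (vertices G r)
    nonempty ε       = s≤s z≤n
    nonempty (_ ◅ _) = s≤s z≤n

  -- Adjacency proofs may differ, so uniqueness concerns vertex lists, which determine the length.
  -- If the second vertex of `p` is not on `q`, prefixing it to `q` gives a path to compare with the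
  -- tail of `p`, and the start of `p` would recur in that tail.
  unique-path : ∀ {x t} (p q : Walk G x t) → Distinct p → Distinct q → vertices G p ≡ vertices G q
  unique-path ε ε _ _ = refl
  unique-path ε (f ◅ q) _ uq = ⊥-elim (start∉ {e = f} q uq (end∈ q))
  unique-path (_◅_ {j = a} e p) q (x∉ ∷ u) uq with a ∈? vertices G q
  ... | yes a∈q with neighbour-second q uq (symm e) a∈q
  ...   | f , q′ , refl with uq
  ...     | _ ∷ uq′ = cong (_ ∷_) (unique-path p q′ u uq′)
  unique-path (e ◅ p) q (x∉ ∷ u) uq | no a∉q = ⊥-elim (start∉ {e = e} p (x∉ ∷ u)
    (subst (_ ∈_) (sym (unique-path p (symm e ◅ q) u (◅-distinct (symm e) q a∉q uq)))
      (there (start∈ q))))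

  sumW : List V → ℚ
  sumW (x ∷ l@(y ∷ _)) = W x y ℚ.+ sumW l
  sumW _               = 0ℚ

  len-vertices : ∀ {x y} (p : Walk G x y) → len p ≡ sumW (vertices G p)
  len-vertices ε               = refl
  len-vertices (_ ◅ ε)         = refl
  len-vertices (_ ◅ p@(_ ◅ _)) = cong (W _ _ ℚ.+_) (len-vertices p)

  D-path : ∀ {x y} (p : Walk G x y) → Distinct p → len p ≡ D x y
  D-path {x} {y} p u with connected x y
  ... | path q v = trans (len-vertices p)
    (trans (cong sumW (unique-path p q u v)) (sym (len-vertices q)))

  D-step : ∀ {a x} t → Adj a x → D a t ≡ W a x ℚ.+ D x t ⊎ D x t ≡ W x a ℚ.+ D a t
  D-step {a} {x} t e with connected x t
  ... | path p u with a ∈? vertices G p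
  ...   | no a∉p = inj₁ (sym (D-path (e ◅ p) (◅-distinct e p a∉p u)))
  ...   | yes a∈p with neighbour-second p u e a∈p
  ...     | f , q , refl with u
  ...       | _ ∷ uq = inj₂ (cong (W x a ℚ.+_) (D-path q uq))

  -- The edges of `w` are moved one by one, reversed, to the front of `p`. It is enough that the
  -- neighbours of `x` on `w` avoid `p`: in a tree, two paths that leave `x` by different edges do
  -- not meet again.
  D-concat : ∀ {x c b} (w : Walk G x c) → Distinct w → (p : Walk G x b) → Distinct p →
    (∀ {z} → z ∈ vertices G w → Adj z x → z ∉ vertices G p) → D c b ≡ len w ℚ.+ len p
  D-concat ε _ p u _ = trans (sym (D-path p u)) (sym (ℚ.+-identityˡ _))
  D-concat {x} (_◅_ {j = y} e w) (x∉ ∷ uw) p u avoid = trans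
    (D-concat w uw (symm e ◅ p) u′ avoid′)
    (trans (cong (λ h → len w ℚ.+ (h ℚ.+ len p)) (W-sym y x))
      (solve 3 (λ h l m → l :+ (h :+ m) := (h :+ l) :+ m) refl (W x y) (len w) (len p)))
    where
    u′ : Distinct (symm e ◅ p)
    u′ = ◅-distinct (symm e) p (avoid (there (start∈ w)) (symm e)) u

    avoid′ : ∀ {z} → z ∈ vertices G w → Adj z y → z ∉ vertices G (symm e ◅ p)
    avoid′ z∈w a z∈p with neighbour-second (symm e ◅ p) u′ a z∈p
    ... | _ , _ , refl = start∉ {e = e} w (x∉ ∷ uw) z∈w

  D-sym : ∀ x y → D x y ≡ D y x
  D-sym x y with connected x y
  ... | path w u = sym (trans
    (D-concat w u ε ([] ∷ []) λ { _ a (here refl) → irrefl refl a })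
    (ℚ.+-identityʳ _))

  -- By `D-step` one edge changes the distance to `z` by exactly its weight; nonnegativity enters
  -- when the edge leads away from `z`.
  walk-triangle : ∀ {x y} z (w : Walk G x y) → D x z ℚ.≤ len w ℚ.+ D y z
  walk-triangle z ε = ℚ.≤-reflexive (sym (ℚ.+-identityˡ _))
  walk-triangle {x} {y} z (_◅_ {j = x′} e w) with D-step z e
  ... | inj₁ eq = ≤-by (walk-triangle z w)
    (trans (solve 4 (λ h l m n → (l :+ m) :- n := ((h :+ l) :+ m) :- (h :+ n)) refl
      (W x x′) (len w) (D y z) (D x′ z)) (cong (λ h → W x x′ ℚ.+ len w ℚ.+ D y z ℚ.- h) (sym eq)))
  ... | inj₂ eq = ≤-by
    (ℚ.+-mono-≤ (ℚ.+-mono-≤ (W-nonNeg x x′ e) (W-nonNeg x x′ e)) (walk-triangle z w))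
    (trans (cong (λ h → W x x′ ℚ.+ W x x′ ℚ.+ (len w ℚ.+ D y z) ℚ.- (0ℚ ℚ.+ 0ℚ ℚ.+ h)) eq)
      (trans (cong (λ h → W x x′ ℚ.+ W x x′ ℚ.+ (len w ℚ.+ D y z) ℚ.- (0ℚ ℚ.+ 0ℚ ℚ.+ (h ℚ.+ D x z))) (W-sym x′ x))
      (solve 4 (λ h l m n → (h :+ h :+ (l :+ m)) :- (con 0ℚ :+ con 0ℚ :+ (h :+ n)) := (h :+ l :+ m) :- n) refl
        (W x x′) (len w) (D y z) (D x z))))

  triangle : ∀ x y z → D x z ℚ.≤ D x y ℚ.+ D y z
  triangle x y z = walk-triangle z (Path.walk (connected x y))

  -- The path from `a` to `b` either starts with the edge `e`, or it leaves the path from `a` to `c`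
  -- already at `a`, and then the two together form the path from `c` to `b`.
  approach : ∀ {a a′ c} b (e : Adj a a′) (w : Walk G a′ c) → Distinct (e ◅ w) →
    D a b ≡ W a a′ ℚ.+ D a′ b ⊎ D c b ≡ len (e ◅ w) ℚ.+ D a b
  approach {a} {a′} b e w uw with connected a b
  ... | path p u with a′ ∈? vertices G p
  ...   | no a′∉p = inj₂ (D-concat (e ◅ w) uw p u avoid)
    where
    avoid : ∀ {z} → z ∈ vertices G (e ◅ w) → Adj z a → z ∉ vertices G p
    avoid z∈w za z∈p with neighbour-second (e ◅ w) uw za z∈w
    ... | _ , _ , refl = a′∉p z∈p
  ...   | yes a′∈p with neighbour-second p u (symm e) a′∈p
  ...     | f , q , refl with u
  ...       | _ ∷ uq = inj₁ (cong (W a a′ ℚ.+_) (D-path q uq))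

  -- Follow the path from `a` to `c` to the point where the path to `b` or to `d` branches off. Each
  -- step before it removes the same edge weight from both sides; at the branching point the claim
  -- is the triangle inequality for `b`, `a`, `d`.
  four-point-walk : ∀ {a c} b d (w : Walk G a c) → Distinct w →
      len w ℚ.+ D b d ℚ.≤ D a b ℚ.+ D c d
    ⊎ len w ℚ.+ D b d ℚ.≤ D a d ℚ.+ D c b
  four-point-walk {a} b d ε _ = inj₁ (ℚ.≤-trans (ℚ.≤-reflexive (ℚ.+-identityˡ _))
    (subst (λ h → D b d ℚ.≤ h ℚ.+ D a d) (D-sym b a) (triangle b a d)))
  four-point-walk {a} {c} b d (_◅_ {j = a′} e w) uw@(_ ∷ uw′) with approach b e w uw | approach d e w uw
  ... | inj₂ eq | _ = inj₂ (≤-by (triangle b a d)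
    (trans (cong (λ h → (h ℚ.+ D a d) ℚ.- D b d) (D-sym b a))
      (trans (solve 4 (λ l m n k → m :+ n :- k := n :+ (l :+ m) :- (l :+ k)) refl
        (len (e ◅ w)) (D a b) (D a d) (D b d))
        (cong (λ h → (D a d ℚ.+ h) ℚ.- (len (e ◅ w) ℚ.+ D b d)) (sym eq)))))
  ... | inj₁ _ | inj₂ eq = inj₁ (≤-by (triangle b a d)
    (trans (cong (λ h → (h ℚ.+ D a d) ℚ.- D b d) (D-sym b a))
      (trans (solve 4 (λ l m n k → m :+ n :- k := m :+ (l :+ n) :- (l :+ k)) refl
        (len (e ◅ w)) (D a b) (D a d) (D b d))
        (cong (λ h → (D a b ℚ.+ h) ℚ.- (len (e ◅ w) ℚ.+ D b d)) (sym eq)))))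
  ... | inj₁ eb | inj₁ ed with four-point-walk b d w uw′
  ...   | inj₁ le = inj₁ (≤-by le
    (trans (solve 5 (λ h l m n k → m :+ n :- (l :+ k) := (h :+ m) :+ n :- (h :+ l :+ k)) refl
      (W a a′) (len w) (D a′ b) (D c d) (D b d))
      (cong (λ h → (h ℚ.+ D c d) ℚ.- (len (e ◅ w) ℚ.+ D b d)) (sym eb))))
  ...   | inj₂ le = inj₂ (≤-by le
    (trans (solve 5 (λ h l m n k → m :+ n :- (l :+ k) := (h :+ m) :+ n :- (h :+ l :+ k)) refl
      (W a a′) (len w) (D a′ d) (D c b) (D b d))
      (cong (λ h → (h ℚ.+ D c b) ℚ.- (len (e ◅ w) ℚ.+ D b d)) (sym ed))))

  four-point : ∀ a b c d → D a c ℚ.+ D b d ℚ.≤ D a b ℚ.+ D c d ⊎ D a c ℚ.+ D b d ℚ.≤ D a d ℚ.+ D c b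
  four-point a b c d with connected a c
  ... | path w u = four-point-walk b d w u

-- A six-point inequality from the four-point condition

module SixPoint {V : Set} (D : V → V → ℚ)
  (D-sym : ∀ x y → D x y ≡ D y x)
  (four-point : ∀ a b c d → D a c ℚ.+ D b d ℚ.≤ D a b ℚ.+ D c d ⊎ D a c ℚ.+ D b d ℚ.≤ D a d ℚ.+ D c b)
  where
  open ℚ-Solver

  cross : ∀ {a c b d} → D a d ℚ.+ D b c ℚ.< D a c ℚ.+ D b d → D a c ℚ.+ D b d ℚ.≤ D a b ℚ.+ D c d
  cross {a} {c} {b} {d} lt with four-point a b c d
  ... | inj₁ le = le
  ... | inj₂ le = ⊥-elim (<⇒≱ lt (subst (λ h → D a c ℚ.+ D b d ℚ.≤ D a d ℚ.+ h) (D-sym c b) le))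

  absurd : ∀ {a b c d} → a ℚ.≤ b → c ℚ.< d → a ℚ.+ c ≡ b ℚ.+ d → ⊥
  absurd a≤b c<d eq = ℚ.<-irrefl eq (ℚ.+-mono-≤-< a≤b c<d)

  -- Each strict inequality on two pairs gives D eᵢ oᵢ + D eⱼ oⱼ ≤ D eᵢ eⱼ + D oᵢ oⱼ.
  -- Adding these to four-point for e₁e₂|o₁o₃, e₂e₃|o₁o₂ and e₁e₃|o₂o₃ cancels all
  -- distances within the eᵢ and within the oᵢ.
  six-point : ∀ e₁ e₂ e₃ o₁ o₂ o₃ →
    D e₁ o₂ ℚ.+ D e₂ o₁ ℚ.< D e₁ o₁ ℚ.+ D e₂ o₂ →
    D e₁ o₃ ℚ.+ D e₃ o₁ ℚ.< D e₁ o₁ ℚ.+ D e₃ o₃ →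
    D e₂ o₃ ℚ.+ D e₃ o₂ ℚ.< D e₂ o₂ ℚ.+ D e₃ o₃ →
    D e₁ o₂ ℚ.+ D e₂ o₃ ℚ.+ D e₃ o₁ ℚ.< D e₁ o₁ ℚ.+ D e₂ o₂ ℚ.+ D e₃ o₃ →
    D e₁ o₃ ℚ.+ D e₂ o₁ ℚ.+ D e₃ o₂ ℚ.< D e₁ o₁ ℚ.+ D e₂ o₂ ℚ.+ D e₃ o₃ → ⊥
  six-point e₁ e₂ e₃ o₁ o₂ o₃ s₁₂ s₁₃ s₂₃ c₁ c₂
    with four-point e₁ o₁ e₂ o₃ | four-point e₂ o₁ e₃ o₂ | four-point e₁ o₂ e₃ o₃
  ... | b₁ | b₂ | b₃ = cases b₁ b₂ b₃
    where
    sums : ∀ {a b c d e f} → a ℚ.≤ b → c ℚ.≤ d → e ℚ.≤ f → _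
    sums p q r = ℚ.+-mono-≤ (ℚ.+-mono-≤ (ℚ.+-mono-≤ (cross s₁₂) (cross s₁₃)) (cross s₂₃))
      (ℚ.+-mono-≤ (ℚ.+-mono-≤ p q) r)

    cases : _ → _ → _ → ⊥
    -- After the cancellation, twice the diagonal sum is at most the sum of the six distances chosen
    -- by the three alternatives. In each of the eight cases that sum, freed of common diagonal
    -- terms, splits into left-hand sides of the strict hypotheses. The index pairs of the `o` are
    -- shifted against those of the `e`, because with equal pairs twice the diagonal sum itself
    -- would be a possible choice.
    cases (inj₁ p) (inj₁ q) (inj₁ r) = absurd (sums p q r) (ℚ.+-mono-< s₁₂ s₂₃)
      (solve 15 (λ x11 x12 x13 x21 x22 x23 x31 x32 x33 e12 e13 e23 o12 o13 o23 →
        (((x11 :+ x22) :+ (x11 :+ x33) :+ (x22 :+ x33)) :+ ((e12 :+ o13) :+ (e23 :+ o12) :+ (e13 :+ o23))) :+ ((x12 :+ x21) :+ (x23 :+ x32))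
        := (((e12 :+ o12) :+ (e13 :+ o13) :+ (e23 :+ o23)) :+ ((x11 :+ x23) :+ (x21 :+ x32) :+ (x12 :+ x33))) :+ ((x11 :+ x22) :+ (x22 :+ x33))) refl
        (D e₁ o₁) (D e₁ o₂) (D e₁ o₃) (D e₂ o₁) (D e₂ o₂) (D e₂ o₃) (D e₃ o₁) (D e₃ o₂) (D e₃ o₃) (D e₁ e₂) (D e₁ e₃) (D e₂ e₃) (D o₁ o₂) (D o₁ o₃) (D o₂ o₃))
    cases (inj₁ p) (inj₁ q) (inj₂ r) = absurd (sums p q r) (ℚ.+-mono-< c₂ s₂₃)
      (solve 15 (λ x11 x12 x13 x21 x22 x23 x31 x32 x33 e12 e13 e23 o12 o13 o23 →
        (((x11 :+ x22) :+ (x11 :+ x33) :+ (x22 :+ x33)) :+ ((e12 :+ o13) :+ (e23 :+ o12) :+ (e13 :+ o23))) :+ ((x13 :+ x21 :+ x32) :+ (x23 :+ x32))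
        := (((e12 :+ o12) :+ (e13 :+ o13) :+ (e23 :+ o23)) :+ ((x11 :+ x23) :+ (x21 :+ x32) :+ (x13 :+ x32))) :+ ((x11 :+ x22 :+ x33) :+ (x22 :+ x33))) refl
        (D e₁ o₁) (D e₁ o₂) (D e₁ o₃) (D e₂ o₁) (D e₂ o₂) (D e₂ o₃) (D e₃ o₁) (D e₃ o₂) (D e₃ o₃) (D e₁ e₂) (D e₁ e₃) (D e₂ e₃) (D o₁ o₂) (D o₁ o₃) (D o₂ o₃))
    cases (inj₁ p) (inj₂ q) (inj₁ r) = absurd (sums p q r) c₁
      (solve 15 (λ x11 x12 x13 x21 x22 x23 x31 x32 x33 e12 e13 e23 o12 o13 o23 →
        (((x11 :+ x22) :+ (x11 :+ x33) :+ (x22 :+ x33)) :+ ((e12 :+ o13) :+ (e23 :+ o12) :+ (e13 :+ o23))) :+ (x12 :+ x23 :+ x31)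
        := (((e12 :+ o12) :+ (e13 :+ o13) :+ (e23 :+ o23)) :+ ((x11 :+ x23) :+ (x22 :+ x31) :+ (x12 :+ x33))) :+ (x11 :+ x22 :+ x33)) refl
        (D e₁ o₁) (D e₁ o₂) (D e₁ o₃) (D e₂ o₁) (D e₂ o₂) (D e₂ o₃) (D e₃ o₁) (D e₃ o₂) (D e₃ o₃) (D e₁ e₂) (D e₁ e₃) (D e₂ e₃) (D o₁ o₂) (D o₁ o₃) (D o₂ o₃))
    cases (inj₁ p) (inj₂ q) (inj₂ r) = absurd (sums p q r) (ℚ.+-mono-< s₁₃ s₂₃)
      (solve 15 (λ x11 x12 x13 x21 x22 x23 x31 x32 x33 e12 e13 e23 o12 o13 o23 →
        (((x11 :+ x22) :+ (x11 :+ x33) :+ (x22 :+ x33)) :+ ((e12 :+ o13) :+ (e23 :+ o12) :+ (e13 :+ o23))) :+ ((x13 :+ x31) :+ (x23 :+ x32))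
        := (((e12 :+ o12) :+ (e13 :+ o13) :+ (e23 :+ o23)) :+ ((x11 :+ x23) :+ (x22 :+ x31) :+ (x13 :+ x32))) :+ ((x11 :+ x33) :+ (x22 :+ x33))) refl
        (D e₁ o₁) (D e₁ o₂) (D e₁ o₃) (D e₂ o₁) (D e₂ o₂) (D e₂ o₃) (D e₃ o₁) (D e₃ o₂) (D e₃ o₃) (D e₁ e₂) (D e₁ e₃) (D e₂ e₃) (D o₁ o₂) (D o₁ o₃) (D o₂ o₃))
    cases (inj₂ p) (inj₁ q) (inj₁ r) = absurd (sums p q r) (ℚ.+-mono-< c₂ s₁₂)
      (solve 15 (λ x11 x12 x13 x21 x22 x23 x31 x32 x33 e12 e13 e23 o12 o13 o23 →
        (((x11 :+ x22) :+ (x11 :+ x33) :+ (x22 :+ x33)) :+ ((e12 :+ o13) :+ (e23 :+ o12) :+ (e13 :+ o23))) :+ ((x13 :+ x21 :+ x32) :+ (x12 :+ x21))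
        := (((e12 :+ o12) :+ (e13 :+ o13) :+ (e23 :+ o23)) :+ ((x13 :+ x21) :+ (x21 :+ x32) :+ (x12 :+ x33))) :+ ((x11 :+ x22 :+ x33) :+ (x11 :+ x22))) refl
        (D e₁ o₁) (D e₁ o₂) (D e₁ o₃) (D e₂ o₁) (D e₂ o₂) (D e₂ o₃) (D e₃ o₁) (D e₃ o₂) (D e₃ o₃) (D e₁ e₂) (D e₁ e₃) (D e₂ e₃) (D o₁ o₂) (D o₁ o₃) (D o₂ o₃))
    cases (inj₂ p) (inj₁ q) (inj₂ r) = absurd (sums p q r) (ℚ.+-mono-< c₂ c₂)
      (solve 15 (λ x11 x12 x13 x21 x22 x23 x31 x32 x33 e12 e13 e23 o12 o13 o23 →
        (((x11 :+ x22) :+ (x11 :+ x33) :+ (x22 :+ x33)) :+ ((e12 :+ o13) :+ (e23 :+ o12) :+ (e13 :+ o23))) :+ ((x13 :+ x21 :+ x32) :+ (x13 :+ x21 :+ x32))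
        := (((e12 :+ o12) :+ (e13 :+ o13) :+ (e23 :+ o23)) :+ ((x13 :+ x21) :+ (x21 :+ x32) :+ (x13 :+ x32))) :+ ((x11 :+ x22 :+ x33) :+ (x11 :+ x22 :+ x33))) refl
        (D e₁ o₁) (D e₁ o₂) (D e₁ o₃) (D e₂ o₁) (D e₂ o₂) (D e₂ o₃) (D e₃ o₁) (D e₃ o₂) (D e₃ o₃) (D e₁ e₂) (D e₁ e₃) (D e₂ e₃) (D o₁ o₂) (D o₁ o₃) (D o₂ o₃))
    cases (inj₂ p) (inj₂ q) (inj₁ r) = absurd (sums p q r) (ℚ.+-mono-< s₁₃ s₁₂)
      (solve 15 (λ x11 x12 x13 x21 x22 x23 x31 x32 x33 e12 e13 e23 o12 o13 o23 →
        (((x11 :+ x22) :+ (x11 :+ x33) :+ (x22 :+ x33)) :+ ((e12 :+ o13) :+ (e23 :+ o12) :+ (e13 :+ o23))) :+ ((x13 :+ x31) :+ (x12 :+ x21))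
        := (((e12 :+ o12) :+ (e13 :+ o13) :+ (e23 :+ o23)) :+ ((x13 :+ x21) :+ (x22 :+ x31) :+ (x12 :+ x33))) :+ ((x11 :+ x33) :+ (x11 :+ x22))) refl
        (D e₁ o₁) (D e₁ o₂) (D e₁ o₃) (D e₂ o₁) (D e₂ o₂) (D e₂ o₃) (D e₃ o₁) (D e₃ o₂) (D e₃ o₃) (D e₁ e₂) (D e₁ e₃) (D e₂ e₃) (D o₁ o₂) (D o₁ o₃) (D o₂ o₃))
    cases (inj₂ p) (inj₂ q) (inj₂ r) = absurd (sums p q r) (ℚ.+-mono-< c₂ s₁₃)
      (solve 15 (λ x11 x12 x13 x21 x22 x23 x31 x32 x33 e12 e13 e23 o12 o13 o23 →
        (((x11 :+ x22) :+ (x11 :+ x33) :+ (x22 :+ x33)) :+ ((e12 :+ o13) :+ (e23 :+ o12) :+ (e13 :+ o23))) :+ ((x13 :+ x21 :+ x32) :+ (x13 :+ x31))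
        := (((e12 :+ o12) :+ (e13 :+ o13) :+ (e23 :+ o23)) :+ ((x13 :+ x21) :+ (x22 :+ x31) :+ (x13 :+ x32))) :+ ((x11 :+ x22 :+ x33) :+ (x11 :+ x33))) refl
        (D e₁ o₁) (D e₁ o₂) (D e₁ o₃) (D e₂ o₁) (D e₂ o₂) (D e₂ o₃) (D e₃ o₁) (D e₃ o₂) (D e₃ o₃) (D e₁ e₂) (D e₁ e₃) (D e₂ e₃) (D o₁ o₂) (D o₁ o₃) (D o₂ o₃))

-- The 3 × 3 × 3 grid

module TreeMetric (T : WeightedTree) where
  open WeightedTree T
  open ℚ-Solver

  -- Exactly symmetric at every index n, whereas weight is so only up to ≃ᴿ.
  W : ℕ → V → V → ℚ
  W n x y = seq (weight x y) n ℚ.+ seq (weight y x) n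

  open module L n = Length graph (W n) public using (len)

  D : ℕ → V → V → ℚ
  D n x y = len n (Path.walk (connected x y))

  -- Mediates between the real `totalWeight`, which weighs each edge in one direction, and the
  -- rational `len`: it equals `len` at every index and, by `weight-sym`, twice the total weight up
  -- to `_≲_`.
  doubled : ∀ {x y} → Walk graph x y → ℝ
  doubled ε                   = 0ᴿ
  doubled (_◅_ {x} {y} _ p) = (weight x y +ᴿ weight y x) +ᴿ doubled p

  doubled-len : ∀ {x y} (p : Walk graph x y) n → seq (doubled p) n ≡ len n p
  doubled-len ε       n = refl
  doubled-len (_◅_ {x} {y} _ p) n = cong (W n x y ℚ.+_) (doubled-len p n)

  twice : ℝ → ℝ
  twice x = x +ᴿ x

  medial : ∀ w t → (w +ᴿ w) +ᴿ (t +ᴿ t) ≲ twice (w +ᴿ t) × twice (w +ᴿ t) ≲ (w +ᴿ w) +ᴿ (t +ᴿ t)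
  medial w t =
    ≲-pointwise {(w +ᴿ w) +ᴿ (t +ᴿ t)} {twice (w +ᴿ t)} (λ n → ℚ.≤-reflexive (eq (seq w n) (seq t n))) ,
    ≲-pointwise {twice (w +ᴿ t)} {(w +ᴿ w) +ᴿ (t +ᴿ t)} (λ n → ℚ.≤-reflexive (sym (eq (seq w n) (seq t n))))
    where
    eq : ∀ a b → (a ℚ.+ a) ℚ.+ (b ℚ.+ b) ≡ (a ℚ.+ b) ℚ.+ (a ℚ.+ b)
    eq = solve 2 (λ a b → (a :+ a) :+ (b :+ b) := (a :+ b) :+ (a :+ b)) refl

  ≲-refl : ∀ x → x ≲ x
  ≲-refl x = ≲-pointwise {x} {x} (λ _ → ℚ.≤-refl)

  doubled-≲ : ∀ {x y} (p : Walk graph x y) →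
    doubled p ≲ twice (totalWeight p) × twice (totalWeight p) ≲ doubled p
  doubled-≲ ε = ≲-refl 0ᴿ , ≲-refl 0ᴿ
  doubled-≲ (_◅_ {x} {y} e p) =
    ≲-trans {doubled (e ◅ p)} {(w +ᴿ w) +ᴿ twice t} {twice (w +ᴿ t)}
      (+-mono-≲ {w +ᴿ w′} {w +ᴿ w} {doubled p} {twice t}
        (+-mono-≲ {w} {w} {w′} {w} (≲-refl w) (≤ᴿ⇒≲ {w′} {w} (proj₂ (weight-sym e))))
        (proj₁ (doubled-≲ p)))
      (proj₁ (medial w t)) ,
    ≲-trans {twice (w +ᴿ t)} {(w +ᴿ w) +ᴿ twice t} {doubled (e ◅ p)}
      (proj₂ (medial w t))
      (+-mono-≲ {w +ᴿ w} {w +ᴿ w′} {twice t} {doubled p}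
        (+-mono-≲ {w} {w} {w} {w′} (≲-refl w) (≤ᴿ⇒≲ {w} {w′} (proj₁ (weight-sym e))))
        (proj₂ (doubled-≲ p)))
    where
    w = weight x y
    w′ = weight y x
    t = totalWeight p

  dist-< : ∀ {u v u′ v′} → dist u v <ᴿ dist u′ v′ → Eventually (λ n → D n u v ℚ.< D n u′ v′)
  dist-< {u} {v} {u′} {v′} lt = ev-map (λ {n} → subst₂ ℚ._<_ (doubled-len p n) (doubled-len q n))
    (<ᴿ⇒ev {doubled p} {doubled q}
      (<-≲-trans {doubled p} {twice (totalWeight q)} {doubled q}
        (≲-<-trans {doubled p} {twice (totalWeight p)} {twice (totalWeight q)}
          (proj₁ (doubled-≲ p))
          (+-double-< {totalWeight p} {totalWeight q} lt))
        (proj₂ (doubled-≲ q))))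
    where
    p = Path.walk (connected u v)
    q = Path.walk (connected u′ v′)

  -- Finiteness of the vertex set gives one threshold for all edges; `adj?` is consulted because
  -- only an actual edge supplies a threshold.
  W-nonNeg : Eventually (λ n → ∀ x y → Adj x y → 0ℚ ℚ.≤ W n x y)
  W-nonNeg = ev-finite finite λ x → ev-finite finite λ y → pointwise x y
    where
    pointwise : ∀ x y → Eventually (λ n → Adj x y → 0ℚ ℚ.≤ W n x y)
    pointwise x y with adj? x y
    ... | no ¬e = 0 , λ _ _ e → ⊥-elim (¬e e)
    ... | yes e = ev-zip (λ p q _ → ℚ.+-mono-≤ (ℚ.<⇒≤ p) (ℚ.<⇒≤ q))
      (<ᴿ⇒ev {0ᴿ} {weight x y} (weight-pos e)) (<ᴿ⇒ev {0ᴿ} {weight y x} (weight-pos (symm e)))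

  six-point : ∀ e₁ e₂ e₃ o₁ o₂ o₃ →
    Eventually (λ n → D n e₁ o₂ ℚ.+ D n e₂ o₁ ℚ.< D n e₁ o₁ ℚ.+ D n e₂ o₂) →
    Eventually (λ n → D n e₁ o₃ ℚ.+ D n e₃ o₁ ℚ.< D n e₁ o₁ ℚ.+ D n e₃ o₃) →
    Eventually (λ n → D n e₂ o₃ ℚ.+ D n e₃ o₂ ℚ.< D n e₂ o₂ ℚ.+ D n e₃ o₃) →
    Eventually (λ n → D n e₁ o₂ ℚ.+ D n e₂ o₃ ℚ.+ D n e₃ o₁ ℚ.< D n e₁ o₁ ℚ.+ D n e₂ o₂ ℚ.+ D n e₃ o₃) →
    Eventually (λ n → D n e₁ o₃ ℚ.+ D n e₂ o₁ ℚ.+ D n e₃ o₂ ℚ.< D n e₁ o₁ ℚ.+ D n e₂ o₂ ℚ.+ D n e₃ o₃) → ⊥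
  six-point e₁ e₂ e₃ o₁ o₂ o₃ s₁₂ s₁₃ s₂₃ c₁ c₂
    with ev-extract (ev-zip _,_ W-nonNeg (ev-zip _,_ (ev-zip _,_ s₁₂ (ev-zip _,_ s₁₃ s₂₃)) (ev-zip _,_ c₁ c₂)))
  ... | n , pos , (h₁₂ , h₁₃ , h₂₃) , k₁ , k₂ =
    SixPoint.six-point (D n) M.D-sym M.four-point e₁ e₂ e₃ o₁ o₂ o₃ h₁₂ h₁₃ h₂₃ k₁ k₂
    where
    module M = Metric graph connected acyclic (W n) (λ x y → ℚ.+-comm (seq (weight x y) n) _) pos

-- Long and short pairs

data Colour : Set where
  long short : Colour

-- A truth value says that a pair of vertices is not adjacent. When such pairs
-- among a, b, c are long and those among x, y, z short, one non-adjacent pair of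
-- two suffices for d x < d a, so a perfect matching of such comparisons gives
-- d x + d y + d z < d a + d b + d c.
beats₂ : (a b x y : Bool) → Bool
beats₂ a b x y = ((a ∨ x) ∧ (b ∨ y)) ∨ ((a ∨ y) ∧ (b ∨ x))

beats₃ : (a b c x y z : Bool) → Bool
beats₃ a b c x y z = ((a ∨ x) ∧ beats₂ b c y z) ∨ ((a ∨ y) ∧ beats₂ b c x z) ∨ ((a ∨ z) ∧ beats₂ b c x y)

-- The conjuncts are the five strict hypotheses of `six-point`, in the same order, with the diagonal
-- pairs in the long role and the others in the short role.
admissible : (Fin 3 → Fin 3 → Bool) → Bool
admissible N =
  beats₂ (N 0F 0F) (N 1F 1F) (N 0F 1F) (N 1F 0F) ∧
  beats₂ (N 0F 0F) (N 2F 2F) (N 0F 2F) (N 2F 0F) ∧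
  beats₂ (N 1F 1F) (N 2F 2F) (N 1F 2F) (N 2F 1F) ∧
  beats₃ (N 0F 0F) (N 1F 1F) (N 2F 2F) (N 0F 1F) (N 1F 2F) (N 2F 0F) ∧
  beats₃ (N 0F 0F) (N 1F 1F) (N 2F 2F) (N 0F 2F) (N 1F 0F) (N 2F 1F)

admissible-cong : ∀ M N → (∀ i j → M i j ≡ N i j) → admissible M ≡ admissible N
admissible-cong M N eq
  rewrite eq 0F 0F | eq 0F 1F | eq 0F 2F | eq 1F 0F | eq 1F 1F | eq 1F 2F | eq 2F 0F | eq 2F 1F | eq 2F 2F = refl

module Hexads (G : Graph) where
  open Graph G

  nonAdj : V × V → Bool
  nonAdj (u , v) = not (does (adj? u v))

  nonAdjs : (e o : Fin 3 → V) → Fin 3 → Fin 3 → Bool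
  nonAdjs e o i j = nonAdj (e i , o j)

  -- All that the search retains of a tree. The dichotomy is doubly negated because the order on
  -- reals is undecidable. Pairs are ordered: throughout the search the vertex of even coordinate
  -- sum comes first.
  record Colouring : Set₁ where
    field
      Has       : Colour → V → V → Set
      dichotomy : ∀ {u v} → u ≢ v → ¬ Adj u v → ¬ ¬ (Has long u v ⊎ Has short u v)

    -- An edge meets both requirements vacuously, since its distance lies between the short and the
    -- long ones; `admissible` makes sure that no comparison rests on two edges.
    Requires : Colour → V × V → Set
    Requires c (u , v) = ¬ Adj u v → Has c u v

    field
      hexad : ∀ e o → T (admissible (nonAdjs e o)) →
        (∀ i → Requires long (e i , o i)) → (∀ {i j} → i ≢ j → Requires short (e i , o j)) → ⊥

module PCGColouring {G : Graph} (P : IsIntervalPCG 1 G) where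
  open Graph G
  open Hexads G
  open IsIntervalPCG P
  open ClosedInterval (interval 0F)
  open TreeMetric tree using (D; dist-<; six-point)

  d : V × V → ℝ
  d (u , v) = WeightedTree.dist tree (ζ u) (ζ v)

  Dₙ : ℕ → V × V → ℚ
  Dₙ n (u , v) = D n (ζ u) (ζ v)

  Has : Colour → V → V → Set
  Has long  u v = hi <ᴿ d (u , v)
  Has short u v = d (u , v) <ᴿ lo

  Requires : Colour → V × V → Set
  Requires c (u , v) = ¬ Adj u v → Has c u v

  edge : ∀ {u v} → Adj u v → d (u , v) ∈ᴵ interval 0F
  edge e with Equivalence.to (adj⇔ (λ u≡v → irrefl u≡v e)) e
  ... | 0F , d∈I = d∈I

  -- A distance neither above `hi` nor below `lo` lies in the interval by the very definition of
  -- `_≤ᴿ_` as a negation, and then `u` and `v` are adjacent.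
  dichotomy : ∀ {u v} → u ≢ v → ¬ Adj u v → ¬ ¬ (Has long u v ⊎ Has short u v)
  dichotomy u≢v ¬e k = ¬e (Equivalence.from (adj⇔ u≢v) (0F , k ∘ inj₂ , k ∘ inj₁))

  beats : ∀ a x → Requires long a → Requires short x → T (nonAdj a ∨ nonAdj x) → Eventually (λ n → Dₙ n x ℚ.< Dₙ n a)
  beats a@(u , v) x@(u′ , v′) la sx na∨nx = dist-< x<a
    where
    x<a : d x <ᴿ d a
    x<a with adj? u v | adj? u′ v′
    ... | yes e | no ¬e′ = <-≤ᴿ-trans {d x} {lo} {d a} (sx ¬e′) (proj₁ (edge e))
    ... | no ¬e | yes e′ = ≤ᴿ-<-trans {d x} {hi} {d a} (proj₂ (edge e′)) (la ¬e)
    ... | no ¬e | no ¬e′ = <-≤ᴿ-trans {d x} {lo} {d a} (sx ¬e′)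
      (<ᴿ⇒≤ᴿ {lo} {d a} (≤ᴿ-<-trans {lo} {hi} {d a} lo≤hi (la ¬e)))

  beats₂-< : ∀ a b x y → Requires long a → Requires long b → Requires short x → Requires short y →
    T (beats₂ (nonAdj a) (nonAdj b) (nonAdj x) (nonAdj y)) → Eventually (λ n → Dₙ n x ℚ.+ Dₙ n y ℚ.< Dₙ n a ℚ.+ Dₙ n b)
  beats₂-< a b x y la lb sx sy t with Equivalence.to T-∨ t
  ... | inj₁ t′ = let p , q = Equivalence.to T-∧ t′ in
    ev-zip ℚ.+-mono-< (beats a x la sx p) (beats b y lb sy q)
  ... | inj₂ t′ = let p , q = Equivalence.to T-∧ t′ in
    ev-zip (λ {n} y<a x<b → subst (ℚ._< Dₙ n a ℚ.+ Dₙ n b) (ℚ.+-comm (Dₙ n y) (Dₙ n x)) (ℚ.+-mono-< y<a x<b))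
      (beats a y la sy p) (beats b x lb sx q)

  beats₃-< : ∀ a b c x y z →
    Requires long a → Requires long b → Requires long c →
    Requires short x → Requires short y → Requires short z →
    T (beats₃ (nonAdj a) (nonAdj b) (nonAdj c) (nonAdj x) (nonAdj y) (nonAdj z)) →
    Eventually (λ n → Dₙ n x ℚ.+ Dₙ n y ℚ.+ Dₙ n z ℚ.< Dₙ n a ℚ.+ Dₙ n b ℚ.+ Dₙ n c)
  beats₃-< a b c x y z la lb lc sx sy sz t = cases (Equivalence.to T-∨ t)
    where
    open ℚ-Solver

    with-a : ∀ v {u w} → Requires short v → T (nonAdj a ∨ nonAdj v) →
      Eventually (λ n → Dₙ n u ℚ.+ Dₙ n w ℚ.< Dₙ n b ℚ.+ Dₙ n c) →
      (∀ n → Dₙ n v ℚ.+ (Dₙ n u ℚ.+ Dₙ n w) ≡ Dₙ n x ℚ.+ Dₙ n y ℚ.+ Dₙ n z) →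
      Eventually (λ n → Dₙ n x ℚ.+ Dₙ n y ℚ.+ Dₙ n z ℚ.< Dₙ n a ℚ.+ Dₙ n b ℚ.+ Dₙ n c)
    with-a v sv p uw<bc eq = ev-zip
      (λ {n} v<a r → subst₂ ℚ._<_ (eq n) (sym (ℚ.+-assoc (Dₙ n a) (Dₙ n b) (Dₙ n c))) (ℚ.+-mono-< v<a r))
      (beats a v la sv p) uw<bc

    cases : T ((nonAdj a ∨ nonAdj x) ∧ beats₂ (nonAdj b) (nonAdj c) (nonAdj y) (nonAdj z)) ⊎
      T (((nonAdj a ∨ nonAdj y) ∧ beats₂ (nonAdj b) (nonAdj c) (nonAdj x) (nonAdj z)) ∨
         ((nonAdj a ∨ nonAdj z) ∧ beats₂ (nonAdj b) (nonAdj c) (nonAdj x) (nonAdj y))) →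
      Eventually (λ n → Dₙ n x ℚ.+ Dₙ n y ℚ.+ Dₙ n z ℚ.< Dₙ n a ℚ.+ Dₙ n b ℚ.+ Dₙ n c)
    cases (inj₁ t′) = let p , q = Equivalence.to T-∧ t′ in
      with-a x sx p (beats₂-< b c y z lb lc sy sz q)
        (λ n → solve 3 (λ x y z → x :+ (y :+ z) := x :+ y :+ z) refl (Dₙ n x) (Dₙ n y) (Dₙ n z))
    cases (inj₂ t′) with Equivalence.to T-∨ t′
    ... | inj₁ t″ = let p , q = Equivalence.to T-∧ t″ in
      with-a y sy p (beats₂-< b c x z lb lc sx sz q)
        (λ n → solve 3 (λ x y z → y :+ (x :+ z) := x :+ y :+ z) refl (Dₙ n x) (Dₙ n y) (Dₙ n z))
    ... | inj₂ t″ = let p , q = Equivalence.to T-∧ t″ in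
      with-a z sz p (beats₂-< b c x y lb lc sx sy q)
        (λ n → solve 3 (λ x y z → z :+ (x :+ y) := x :+ y :+ z) refl (Dₙ n x) (Dₙ n y) (Dₙ n z))

  hexad : ∀ e o → T (admissible (nonAdjs e o)) →
    (∀ i → Requires long (e i , o i)) → (∀ {i j} → i ≢ j → Requires short (e i , o j)) → ⊥
  hexad e o t l s =
    let t₁₂ , r₁ = Equivalence.to T-∧ t
        t₁₃ , r₂ = Equivalence.to T-∧ r₁
        t₂₃ , r₃ = Equivalence.to T-∧ r₂
        u , v = Equivalence.to T-∧ r₃
    in six-point (ζ (e 0F)) (ζ (e 1F)) (ζ (e 2F)) (ζ (o 0F)) (ζ (o 1F)) (ζ (o 2F))
      (beats₂-< _ _ _ _ (l 0F) (l 1F) (s λ ()) (s λ ()) t₁₂)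
      (beats₂-< _ _ _ _ (l 0F) (l 2F) (s λ ()) (s λ ()) t₁₃)
      (beats₂-< _ _ _ _ (l 1F) (l 2F) (s λ ()) (s λ ()) t₂₃)
      (beats₃-< _ _ _ _ _ _ (l 0F) (l 1F) (l 2F) (s λ ()) (s λ ()) (s λ ()) u)
      (beats₃-< _ _ _ _ _ _ (l 0F) (l 1F) (l 2F) (s λ ()) (s λ ()) (s λ ()) v)

  colouring : Colouring
  colouring = record { Has = Has ; dichotomy = dichotomy ; hexad = hexad }

-- Symmetries of the 3 × 3 × 3 grid

Cube : Graph
Cube = Grid 3 3 3

module _ where
  open Graph Cube
  open Hexads Cube

  -- Two transpositions of coordinates and one reflection generate all 48 symmetries of the cube.
  -- The reflection sends x to 2 - x, so each of them keeps the parity of the coordinate sum.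
  data Generator : Set where
    σ₁₂ σ₂₃ ρ : Generator

  move : Generator → V → V
  move σ₁₂ (x , y , z) = y , x , z
  move σ₂₃ (x , y , z) = x , z , y
  move ρ   (x , y , z) = opposite x , y , z

  move-involutive : ∀ g v → move g (move g v) ≡ v
  move-involutive σ₁₂ _           = refl
  move-involutive σ₂₃ _           = refl
  move-involutive ρ   (x , y , z) = cong (_, y , z) (opposite-involutive x)

  move-injective : ∀ g {u v} → move g u ≡ move g v → u ≡ v
  move-injective g {u} {v} eq = trans (sym (move-involutive g u)) (trans (cong (move g) eq) (move-involutive g v))

  opposite-differ : ∀ (i j : Fin 3) → DifferByOne i j → DifferByOne (opposite i) (opposite j)
  opposite-differ 0F 1F _ = refl
  opposite-differ 1F 0F _ = refl
  opposite-differ 1F 2F _ = refl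
  opposite-differ 2F 1F _ = refl
  opposite-differ 2F 2F ()

  move-adj : ∀ g {u v} → Adj u v → Adj (move g u) (move g v)
  move-adj σ₁₂ (inj₁ (d , e , f))        = inj₂ (inj₁ (e , d , f))
  move-adj σ₁₂ (inj₂ (inj₁ (d , e , f))) = inj₁ (e , d , f)
  move-adj σ₁₂ (inj₂ (inj₂ (d , e , f))) = inj₂ (inj₂ (e , d , f))
  move-adj σ₂₃ (inj₁ (d , e , f))        = inj₁ (d , f , e)
  move-adj σ₂₃ (inj₂ (inj₁ (d , e , f))) = inj₂ (inj₂ (d , f , e))
  move-adj σ₂₃ (inj₂ (inj₂ (d , e , f))) = inj₂ (inj₁ (d , f , e))
  move-adj ρ {x , _} {x′ , _} (inj₁ (d , e , f)) = inj₁ (opposite-differ x x′ d , e , f)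
  move-adj ρ   (inj₂ (inj₁ (d , e , f))) = inj₂ (inj₁ (cong opposite d , e , f))
  move-adj ρ   (inj₂ (inj₂ (d , e , f))) = inj₂ (inj₂ (cong opposite d , e , f))

  move-adj⁻ : ∀ g {u v} → Adj (move g u) (move g v) → Adj u v
  move-adj⁻ g {u} {v} e = subst₂ Adj (move-involutive g u) (move-involutive g v) (move-adj g e)

  move-nonAdj : ∀ g u v → nonAdj (move g u , move g v) ≡ nonAdj (u , v)
  move-nonAdj g u v = cong not
    (does-⇔ (mk⇔ (move-adj⁻ g) (move-adj g)) (adj? (move g u) (move g v)) (adj? u v))

  moved : Generator → Colouring → Colouring
  moved g K = record
    { Has       = λ c u v → Has c (move g u) (move g v)
    ; dichotomy = λ u≢v ¬e → dichotomy (u≢v ∘ move-injective g) (¬e ∘ move-adj⁻ g)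
    ; hexad     = λ e o t l s → hexad (move g ∘ e) (move g ∘ o)
        (subst T (admissible-cong (nonAdjs e o) (nonAdjs (move g ∘ e) (move g ∘ o))
          (λ i j → sym (move-nonAdj g (e i) (o j)))) t)
        (λ i → l i ∘ (_∘ move-adj g)) (λ i≢j → s i≢j ∘ (_∘ move-adj g))
    }
    where open Colouring K

-- A verified checker for unit propagation

module _ where
  open Graph Cube
  open Hexads Cube

  Literal : Set
  Literal = Colour × V × V

  -- A clause is the conjunction of its literals, and is to be refuted.
  Clause : Set
  Clause = List Literal

  _≟ᶜ_ : DecidableEquality Colour
  long  ≟ᶜ long  = yes refl
  long  ≟ᶜ short = no λ ()
  short ≟ᶜ long  = no λ ()
  short ≟ᶜ short = yes refl

  _≟ᵛ_ : DecidableEquality V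
  _≟ᵛ_ = ≡-dec _≟ᶠ_ (≡-dec _≟ᶠ_ _≟ᶠ_)

  _≟ˡ_ : DecidableEquality Literal
  _≟ˡ_ = ≡-dec _≟ᶜ_ (≡-dec _≟ᵛ_ _≟ᵛ_)

  open import Data.List.Membership.DecPropositional _≟ˡ_ using (_∈?_)

  Holds : Colouring → Literal → Set
  Holds K (c , u , v) = Colouring.Has K c u v

  -- Quantifying over all colourings closes refuted clauses under symmetries, which act on the
  -- colouring by `moved`.
  Refuted : Clause → Set₁
  Refuted C = ∀ K → ¬ All (Holds K) C

  moveˡ : Generator → Literal → Literal
  moveˡ g (c , u , v) = c , move g u , move g v

  -- The head of the list acts last.
  transport : List Generator → Clause → Clause
  transport []       C = C
  transport (g ∷ gs) C = map (moveˡ g) (transport gs C)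

  transport-refuted : ∀ gs {C} → Refuted C → Refuted (transport gs C)
  transport-refuted []       r   = r
  transport-refuted (g ∷ gs) r K = transport-refuted gs r (moved g K) ∘ All.map⁻

  requirement : Colour × V × V → Clause
  requirement l@(c , u , v) with adj? u v
  ... | yes _ = []
  ... | no _  = l ∷ []

  requirement-sound : ∀ K c u v → All (Holds K) (requirement (c , u , v)) → Colouring.Requires K c (u , v)
  requirement-sound K c u v h ¬e with adj? u v
  ... | yes e = ⊥-elim (¬e e)
  ... | no _  = All.head h

  requirements-sound : ∀ K ls → All (Holds K) (concat (map requirement ls)) →
    All (λ (c , u , v) → Colouring.Requires K c (u , v)) ls
  requirements-sound K []               _ = []
  requirements-sound K (l@(c , u , v) ∷ ls) h =
    let p , q = All.++⁻ (requirement l) h in requirement-sound K c u v p ∷ requirements-sound K ls q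

  triple : ∀ {A : Set} → A → A → A → Fin 3 → A
  triple x y z 0F = x
  triple x y z 1F = y
  triple x y z 2F = z

  hexadLiterals : (e o : Fin 3 → V) → List Literal
  hexadLiterals e o =
    ( (long , e 0F , o 0F) ∷ (long , e 1F , o 1F) ∷ (long , e 2F , o 2F)
    ∷ (short , e 0F , o 1F) ∷ (short , e 0F , o 2F) ∷ (short , e 1F , o 0F)
    ∷ (short , e 1F , o 2F) ∷ (short , e 2F , o 0F) ∷ (short , e 2F , o 1F) ∷ [])

  hexadClause : (e o : Fin 3 → V) → Clause
  hexadClause e o = concat (map requirement (hexadLiterals e o))

  hexad-refuted : ∀ e o → T (admissible (nonAdjs e o)) → Refuted (hexadClause e o)
  hexad-refuted e o t K h with requirements-sound K (hexadLiterals e o) h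
  ... | h₀ ∷ h₁ ∷ h₂ ∷ k₀₁ ∷ k₀₂ ∷ k₁₀ ∷ k₁₂ ∷ k₂₀ ∷ k₂₁ ∷ [] = Colouring.hexad K e o t
    (λ { 0F → h₀ ; 1F → h₁ ; 2F → h₂ })
    (λ { {0F} {0F} i≢i → ⊥-elim (i≢i refl) ; {0F} {1F} _ → k₀₁ ; {0F} {2F} _ → k₀₂
       ; {1F} {0F} _ → k₁₀ ; {1F} {1F} i≢i → ⊥-elim (i≢i refl) ; {1F} {2F} _ → k₁₂
       ; {2F} {0F} _ → k₂₀ ; {2F} {1F} _ → k₂₁ ; {2F} {2F} i≢i → ⊥-elim (i≢i refl) })

  hexadPremise : (e o : Fin 3 → V) → List Clause
  hexadPremise e o with T? (admissible (nonAdjs e o))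
  ... | yes _ = hexadClause e o ∷ []
  ... | no _  = []

  hexadPremise-refuted : ∀ e o → All Refuted (hexadPremise e o)
  hexadPremise-refuted e o with T? (admissible (nonAdjs e o))
  ... | yes t = hexad-refuted e o t ∷ []
  ... | no _  = []

  -- A vertex is written as the decimal numeral with its coordinates as digits.
  vertex : ℕ → V
  vertex n = digit (n / 100) , digit (n / 10 % 10) , digit (n % 10)
    where
    digit : ℕ → Fin 3
    digit 0 = 0F
    digit 1 = 1F
    digit _ = 2F

  data Step : Set where
    hex  : (e₁ o₁ e₂ o₂ e₃ o₃ : ℕ) → Step
    cite : ℕ → List Generator → Step

  -- At most one clause; the empty list marks an invalid step, that is an inadmissible hexad or a
  -- citation out of range, and makes the check fail.
  premise : List Clause → Step → List Clause
  premise Δ (hex e₁ o₁ e₂ o₂ e₃ o₃) = hexadPremise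
    (triple (vertex e₁) (vertex e₂) (vertex e₃)) (triple (vertex o₁) (vertex o₂) (vertex o₃))
  premise []      (cite _ _)        = []
  premise (C ∷ _) (cite zero gs)    = transport gs C ∷ []
  premise (_ ∷ Δ) (cite (suc n) gs) = premise Δ (cite n gs)

  premise-refuted : ∀ {Δ} → All Refuted Δ → ∀ s → All Refuted (premise Δ s)
  premise-refuted _ (hex e₁ o₁ e₂ o₂ e₃ o₃) = hexadPremise-refuted
    (triple (vertex e₁) (vertex e₂) (vertex e₃)) (triple (vertex o₁) (vertex o₂) (vertex o₃))
  premise-refuted []      (cite _ _)        = []
  premise-refuted (r ∷ _) (cite zero gs)    = transport-refuted gs r ∷ []
  premise-refuted (_ ∷ δ) (cite (suc n) gs) = premise-refuted δ (cite n gs)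

  missing : Clause → Clause → Clause
  missing Γ []      = []
  missing Γ (l ∷ C) with l ∈? Γ
  ... | yes _ = missing Γ C
  ... | no _  = l ∷ missing Γ C

  missing-sound : ∀ K Γ C → All (Holds K) Γ → All (Holds K) (missing Γ C) → All (Holds K) C
  missing-sound K Γ []      _ _ = []
  missing-sound K Γ (l ∷ C) γ m with l ∈? Γ
  missing-sound K Γ (l ∷ C) γ m       | yes l∈Γ = All.lookup γ l∈Γ ∷ missing-sound K Γ C γ m
  missing-sound K Γ (l ∷ C) γ (h ∷ m) | no _    = h ∷ missing-sound K Γ C γ m

  NonEdge : Literal → Set
  NonEdge (_ , u , v) = u ≢ v × ¬ Adj u v

  nonEdge? : ∀ l → Dec (NonEdge l)
  nonEdge? (_ , u , v) = ¬? (u ≟ᵛ v) ×-dec ¬? (adj? u v)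

  negate : Literal → Literal
  negate (long  , u , v) = short , u , v
  negate (short , u , v) = long , u , v

  -- With conclusion `⊥`, the doubly negated dichotomy is as good as a decision.
  switch : ∀ K l → NonEdge l → ¬ Holds K l → (Holds K (negate l) → ⊥) → ⊥
  switch K (long  , _) (u≢v , ¬e) ¬h k = Colouring.dichotomy K u≢v ¬e Sum.[ ¬h , k ]
  switch K (short , _) (u≢v , ¬e) ¬h k = Colouring.dichotomy K u≢v ¬e Sum.[ k , ¬h ]

  -- Unit propagation: each step contributes a refuted clause of which at most
  -- one literal is not yet known to hold; hence the opposite of that literal holds.
  propagates : List Clause → Clause → List Step → Bool
  propagates Δ Γ []       = false
  propagates Δ Γ (s ∷ ss) with premise Δ s
  ... | []    = false
  ... | C ∷ _ with missing Γ C
  ...   | []        = true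
  ...   | _ ∷ _ ∷ _ = false
  ...   | l ∷ []    with nonEdge? l
  ...     | yes _ = propagates Δ (negate l ∷ Γ) ss
  ...     | no _  = false

  propagates-sound : ∀ {Δ} → All Refuted Δ → ∀ Γ ss → T (propagates Δ Γ ss) → Refuted Γ
  propagates-sound {Δ} δ Γ (s ∷ ss) t K γ with premise Δ s | premise-refuted δ s
  ... | C ∷ _ | r ∷ _ with missing Γ C | missing-sound K Γ C γ
  ...   | []     | m = r K (m [])
  ...   | l ∷ [] | m with nonEdge? l
  ...     | yes ne = switch K l ne (λ h → r K (m (h ∷ [])))
    (λ h → propagates-sound δ (negate l ∷ Γ) ss t K (h ∷ γ))

  Derivation : Set
  Derivation = List ((List (Colour × ℕ × ℕ)) × List Step)

  clause : List (Colour × ℕ × ℕ) → Clause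
  clause = map λ (c , m , n) → c , vertex m , vertex n

  -- A proved clause is appended at the end, so `cite n` always refers to entry `n` of the
  -- derivation, counted from 0.
  derives : List Clause → Derivation → List Step → Bool
  derives Δ []             ss = propagates Δ [] ss
  derives Δ ((C , ss′) ∷ d) ss = propagates Δ (clause C) ss′ ∧ derives (Δ ∷ʳ clause C) d ss

  derives-sound : ∀ {Δ} → All Refuted Δ → ∀ d ss → T (derives Δ d ss) → Refuted []
  derives-sound δ []             ss t = propagates-sound δ [] ss t
  derives-sound δ ((C , ss′) ∷ d) ss t = let p , q = Equivalence.to T-∧ t in
    derives-sound (All.∷ʳ⁺ δ (propagates-sound δ (clause C) ss′ p)) d ss q

  -- Found by a computer search with clause learning modulo the symmetries of the cube.
  lemmas : Derivation
  lemmas =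
    ( ( ( (long , 121 , 210) ∷ (short , 101 , 122) ∷ (short , 112 , 210) ∷ (short , 011 , 210) ∷
           (short , 101 , 210) ∷ [])
       ,
         ( hex 011 122 101 111 121 210 ∷ hex 011 021 112 122 121 210 ∷
           hex 101 111 112 021 121 210 ∷ hex 022 122 101 021 121 210 ∷
           hex 022 210 101 012 112 122 ∷ hex 011 012 022 210 101 021 ∷ []) )
    ∷ ( ( (short , 011 , 122) ∷ (long , 211 , 122) ∷ (short , 101 , 122) ∷ (short , 110 , 122) ∷
           [])
       ,
         ( cite 0 (σ₂₃ ∷ σ₁₂ ∷ ρ ∷ σ₁₂ ∷ σ₂₃ ∷ σ₁₂ ∷ []) ∷
           cite 0 (σ₁₂ ∷ ρ ∷ σ₁₂ ∷ σ₂₃ ∷ σ₁₂ ∷ []) ∷ hex 011 210 101 111 211 122 ∷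
           hex 011 201 110 111 211 122 ∷ hex 101 210 110 201 211 122 ∷ []) )
    ∷ ( ( (short , 110 , 122) ∷ (short , 112 , 210) ∷ (long , 101 , 210) ∷ (short , 211 , 122) ∷
           (short , 011 , 221) ∷ (short , 101 , 122) ∷ (short , 101 , 221) ∷ [])
       ,
         ( hex 101 210 211 221 220 122 ∷ hex 101 210 112 122 211 221 ∷
           hex 101 210 112 122 220 111 ∷ hex 011 122 101 111 112 221 ∷
           hex 011 111 101 210 112 221 ∷ cite 1 (σ₂₃ ∷ σ₁₂ ∷ []) ∷ hex 011 210 112 122 211 012 ∷
           hex 011 210 112 122 220 012 ∷ hex 011 210 110 012 112 122 ∷
           hex 101 120 110 221 121 122 ∷ hex 110 221 121 122 211 120 ∷
           hex 011 012 110 221 121 122 ∷ hex 101 111 121 012 220 120 ∷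
           hex 101 012 211 111 220 120 ∷ []) )
    ∷ ( ( (short , 101 , 221) ∷ (long , 110 , 221) ∷ (short , 110 , 122) ∷ (short , 211 , 122) ∷
           (short , 101 , 210) ∷ (short , 101 , 212) ∷ (short , 011 , 221) ∷ [])
       ,
         ( hex 110 221 121 122 211 120 ∷ cite 1 (σ₂₃ ∷ σ₁₂ ∷ ρ ∷ []) ∷
           hex 011 212 101 111 112 221 ∷ hex 101 111 110 221 121 210 ∷
           hex 011 210 101 111 110 221 ∷ hex 101 111 112 221 121 212 ∷
           hex 110 221 121 122 211 212 ∷ hex 101 111 110 212 112 210 ∷
           cite 2 (σ₂₃ ∷ σ₁₂ ∷ ρ ∷ σ₁₂ ∷ σ₂₃ ∷ σ₁₂ ∷ []) ∷ hex 112 221 121 120 211 210 ∷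
           hex 011 120 110 221 121 122 ∷ hex 011 111 110 212 112 120 ∷ []) )
    ∷ ( ( (short , 011 , 221) ∷ (short , 112 , 210) ∷ (short , 101 , 221) ∷ (short , 011 , 122) ∷
           (short , 101 , 122) ∷ (short , 110 , 122) ∷ [])
       ,
         ( cite 1 [] ∷ cite 2 [] ∷ hex 101 212 112 122 211 210 ∷ cite 3 [] ∷
           cite 1 (σ₂₃ ∷ σ₁₂ ∷ []) ∷ hex 011 210 112 122 211 221 ∷ hex 110 212 112 122 211 221 ∷
           hex 011 212 112 122 211 221 ∷ cite 0 [] ∷ cite 1 (σ₁₂ ∷ []) ∷
           hex 110 210 112 212 121 221 ∷ []) )
    ∷ ( ( (short , 110 , 122) ∷ (short , 110 , 021) ∷ (long , 202 , 021) ∷ (short , 202 , 122) ∷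
           (long , 110 , 102) ∷ [])
       ,
         ( hex 110 102 112 122 202 111 ∷ hex 022 122 110 111 202 021 ∷
           hex 110 102 112 122 202 021 ∷ hex 011 122 110 111 202 021 ∷
           hex 022 111 110 012 112 021 ∷ hex 022 111 112 021 121 012 ∷
           hex 110 102 112 122 202 012 ∷ hex 011 012 121 122 202 021 ∷ []) )
    ∷ ( ( (long , 112 , 210) ∷ (short , 101 , 122) ∷ (short , 112 , 221) ∷ (short , 101 , 221) ∷
           (long , 211 , 021) ∷ (short , 101 , 210) ∷ [])
       ,
         ( hex 101 111 112 210 211 122 ∷ hex 101 111 110 221 112 210 ∷
           hex 101 111 110 122 112 210 ∷ cite 1 (ρ ∷ []) ∷ hex 011 221 121 122 211 021 ∷
           cite 4 (σ₁₂ ∷ σ₂₃ ∷ σ₁₂ ∷ []) ∷ hex 101 111 112 210 211 012 ∷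
           hex 022 122 101 012 112 210 ∷ hex 022 221 101 012 112 122 ∷ cite 5 (σ₂₃ ∷ σ₁₂ ∷ []) ∷
           hex 011 021 022 210 101 012 ∷ hex 011 210 101 111 211 021 ∷ []) )
    ∷ ( ( (short , 101 , 122) ∷ (short , 101 , 221) ∷ (short , 211 , 122) ∷ (short , 110 , 122) ∷
           (short , 011 , 221) ∷ (short , 110 , 221) ∷ [])
       ,
         ( cite 1 (σ₂₃ ∷ σ₁₂ ∷ []) ∷ hex 110 212 112 122 211 221 ∷ cite 4 (σ₁₂ ∷ σ₂₃ ∷ σ₁₂ ∷ []) ∷
           cite 1 (ρ ∷ []) ∷ hex 101 212 112 122 211 221 ∷ hex 011 212 112 122 211 012 ∷
           cite 4 [] ∷ cite 1 (σ₁₂ ∷ []) ∷ cite 4 (σ₁₂ ∷ []) ∷ cite 4 (σ₂₃ ∷ σ₁₂ ∷ []) ∷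
           cite 6 (σ₂₃ ∷ σ₁₂ ∷ []) ∷ cite 6 (σ₁₂ ∷ σ₂₃ ∷ σ₁₂ ∷ []) ∷ hex 011 102 101 012 112 122 ∷
           []) )
    ∷ ( ( (short , 101 , 122) ∷ (short , 110 , 122) ∷ (short , 011 , 122) ∷ (long , 101 , 210) ∷
           (short , 101 , 221) ∷ (short , 011 , 221) ∷ [])
       ,
         ( cite 7 (σ₁₂ ∷ σ₂₃ ∷ σ₁₂ ∷ []) ∷ cite 1 [] ∷ cite 1 (σ₂₃ ∷ σ₁₂ ∷ []) ∷
           hex 110 221 121 122 211 120 ∷ hex 101 120 110 221 121 122 ∷
           hex 011 120 110 221 121 122 ∷ hex 101 210 110 221 220 111 ∷
           hex 101 210 110 221 211 100 ∷ hex 101 210 110 221 220 100 ∷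
           hex 011 111 101 210 110 221 ∷ hex 011 210 110 120 211 010 ∷
           hex 011 100 211 111 220 120 ∷ hex 011 210 110 100 220 010 ∷
           hex 011 010 101 100 220 120 ∷ hex 101 010 211 111 220 120 ∷ []) )
    ∷ ( ( (short , 101 , 221) ∷ (short , 011 , 122) ∷ (short , 101 , 122) ∷ (short , 110 , 122) ∷
           (long , 101 , 210) ∷ [])
       ,
         ( cite 1 [] ∷ cite 8 [] ∷ hex 101 210 211 221 220 122 ∷ hex 011 221 121 122 220 021 ∷
           hex 011 221 121 122 211 021 ∷ hex 011 221 101 021 121 122 ∷ cite 7 (ρ ∷ []) ∷
           hex 101 120 110 021 121 122 ∷ hex 101 210 110 021 220 120 ∷ []) )
    ∷ ( ( (short , 101 , 122) ∷ (short , 101 , 221) ∷ (long , 011 , 221) ∷ (short , 011 , 122) ∷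
           (short , 110 , 122) ∷ [])
       ,
         ( cite 9 [] ∷ cite 1 [] ∷ hex 011 221 101 021 121 122 ∷ hex 011 221 121 122 211 021 ∷
           cite 7 (ρ ∷ []) ∷ hex 011 120 110 021 121 122 ∷ hex 110 021 121 122 211 120 ∷
           hex 011 210 101 111 110 021 ∷ hex 101 111 110 021 121 210 ∷
           hex 011 221 121 120 211 210 ∷ []) )
    ∷ ( ( (short , 110 , 122) ∷ (short , 101 , 122) ∷ (short , 211 , 122) ∷ (short , 101 , 221) ∷
           [])
       ,
         ( cite 1 (ρ ∷ []) ∷ cite 9 [] ∷ cite 10 [] ∷ cite 7 (σ₁₂ ∷ σ₂₃ ∷ σ₁₂ ∷ []) ∷ cite 7 [] ∷
           cite 3 [] ∷ hex 011 210 101 111 110 221 ∷ hex 101 212 112 221 222 111 ∷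
           hex 101 212 211 210 222 122 ∷ hex 011 111 110 221 222 210 ∷ []) )
    ∷ ( ( (long , 110 , 212) ∷ (short , 011 , 221) ∷ (short , 110 , 122) ∷ (short , 110 , 221) ∷
           (short , 211 , 122) ∷ [])
       ,
         ( hex 110 212 112 122 211 221 ∷ hex 011 111 110 212 112 221 ∷
           hex 011 122 110 111 112 221 ∷ hex 110 212 112 221 222 111 ∷
           hex 011 212 112 122 211 012 ∷ hex 011 212 112 221 222 012 ∷
           hex 110 012 211 111 222 122 ∷ hex 121 012 211 111 222 122 ∷
           cite 11 (ρ ∷ σ₁₂ ∷ σ₂₃ ∷ []) ∷ []) )
    ∷ ( ( (short , 011 , 221) ∷ (short , 011 , 210) ∷ (long , 110 , 221) ∷ (long , 110 , 212) ∷ [])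
       ,
         ( hex 011 111 110 221 121 210 ∷ cite 11 (σ₂₃ ∷ σ₁₂ ∷ ρ ∷ σ₁₂ ∷ σ₂₃ ∷ σ₁₂ ∷ []) ∷
           hex 110 212 112 210 121 111 ∷ hex 011 111 110 221 112 210 ∷
           hex 011 111 110 212 112 210 ∷ hex 112 221 121 212 211 122 ∷
           hex 112 221 121 212 222 111 ∷ hex 011 212 112 210 211 012 ∷
           hex 011 212 112 221 222 012 ∷ hex 011 111 110 221 222 210 ∷
           hex 121 012 211 111 222 122 ∷ hex 011 212 211 210 222 122 ∷
           hex 110 012 112 210 121 111 ∷ cite 11 (ρ ∷ σ₁₂ ∷ []) ∷ hex 011 122 022 111 211 021 ∷
           hex 011 122 022 210 211 021 ∷ hex 022 012 112 210 121 111 ∷ []) )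
    ∷ ( ( (short , 011 , 210) ∷ (long , 110 , 221) ∷ (short , 011 , 221) ∷ [])
       ,
         ( hex 011 111 110 221 121 210 ∷ cite 13 [] ∷
           cite 11 (σ₂₃ ∷ σ₁₂ ∷ ρ ∷ σ₁₂ ∷ σ₂₃ ∷ σ₁₂ ∷ []) ∷ hex 011 111 110 221 112 210 ∷
           cite 13 (σ₂₃ ∷ σ₁₂ ∷ ρ ∷ σ₁₂ ∷ σ₂₃ ∷ []) ∷ hex 011 212 112 210 211 012 ∷
           hex 011 212 112 221 222 012 ∷ hex 011 212 112 210 121 111 ∷
           hex 011 212 110 221 222 210 ∷ hex 011 212 110 012 112 210 ∷
           hex 110 122 112 210 121 212 ∷ hex 112 210 121 012 222 122 ∷
           cite 11 (ρ ∷ σ₁₂ ∷ σ₂₃ ∷ []) ∷ []) )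
    ∷ ( ( (short , 110 , 122) ∷ (short , 211 , 122) ∷ (short , 011 , 221) ∷ (long , 011 , 122) ∷
           [])
       ,
         ( cite 14 (σ₁₂ ∷ σ₂₃ ∷ σ₁₂ ∷ []) ∷ hex 011 122 022 111 110 012 ∷
           hex 011 122 110 012 112 010 ∷ hex 011 122 110 012 211 111 ∷
           hex 011 122 112 221 211 012 ∷ hex 011 122 022 221 211 012 ∷
           hex 011 122 112 021 121 221 ∷ cite 12 (ρ ∷ σ₁₂ ∷ σ₂₃ ∷ σ₁₂ ∷ []) ∷
           hex 011 122 110 111 211 021 ∷ hex 011 122 110 021 121 221 ∷
           hex 110 221 121 122 211 120 ∷ hex 022 122 110 221 222 111 ∷
           hex 011 122 110 221 211 010 ∷ hex 011 122 121 120 211 021 ∷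
           hex 020 010 112 120 211 021 ∷ hex 011 120 112 111 222 221 ∷
           hex 110 221 112 111 222 120 ∷ []) )
    ∷ ( ( (short , 011 , 122) ∷ (short , 110 , 122) ∷ (short , 011 , 221) ∷ (long , 110 , 221) ∷
           [])
       ,
         ( cite 15 (σ₁₂ ∷ σ₂₃ ∷ σ₁₂ ∷ []) ∷ cite 14 (σ₂₃ ∷ σ₁₂ ∷ ρ ∷ σ₁₂ ∷ σ₂₃ ∷ []) ∷
           hex 011 212 112 221 211 012 ∷ hex 011 212 112 221 222 012 ∷
           hex 011 212 112 221 222 111 ∷ hex 011 111 112 221 211 122 ∷
           hex 011 012 110 221 222 122 ∷ hex 110 012 211 111 222 122 ∷ []) )
    ∷ ( ( (short , 211 , 122) ∷ (short , 110 , 122) ∷ (short , 011 , 221) ∷ [])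
       ,
         ( cite 15 [] ∷ cite 16 [] ∷ cite 12 [] ∷ cite 14 (σ₁₂ ∷ ρ ∷ σ₁₂ ∷ σ₂₃ ∷ σ₁₂ ∷ []) ∷
           cite 11 (σ₁₂ ∷ []) ∷ cite 12 (σ₁₂ ∷ σ₂₃ ∷ σ₁₂ ∷ []) ∷ hex 011 212 110 111 112 221 ∷ []) )
    ∷ ( ( (short , 110 , 122) ∷ (short , 211 , 122) ∷ (short , 011 , 122) ∷ [])
       ,
         ( cite 17 [] ∷ cite 17 (ρ ∷ []) ∷ hex 011 221 121 122 211 021 ∷ []) )
    ∷ ( ( (short , 110 , 122) ∷ (short , 110 , 212) ∷ [])
       ,
         ( cite 14 (ρ ∷ σ₁₂ ∷ σ₂₃ ∷ σ₁₂ ∷ []) ∷ cite 18 [] ∷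
           cite 14 (σ₁₂ ∷ ρ ∷ σ₁₂ ∷ σ₂₃ ∷ σ₁₂ ∷ []) ∷ cite 14 (σ₁₂ ∷ σ₂₃ ∷ σ₁₂ ∷ []) ∷
           hex 011 122 022 010 110 012 ∷ hex 011 122 110 012 112 010 ∷
           hex 011 122 110 012 112 212 ∷ hex 011 122 022 111 110 012 ∷
           hex 011 212 110 012 121 111 ∷ hex 011 212 112 021 121 012 ∷
           hex 022 021 112 111 121 010 ∷ hex 110 010 121 122 211 212 ∷
           hex 011 212 121 111 211 010 ∷ []) )
    ∷ ( ( (short , 211 , 122) ∷ (short , 110 , 122) ∷ [])
       ,
         ( cite 19 [] ∷ cite 19 (ρ ∷ []) ∷ cite 18 [] ∷ cite 1 (ρ ∷ []) ∷
           hex 011 122 110 012 112 010 ∷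
           cite 19 (ρ ∷ σ₁₂ ∷ ρ ∷ σ₂₃ ∷ σ₁₂ ∷ ρ ∷ σ₁₂ ∷ σ₂₃ ∷ σ₁₂ ∷ []) ∷
           hex 110 212 112 122 211 010 ∷ hex 101 122 110 010 112 100 ∷
           hex 011 122 121 010 211 111 ∷ cite 1 (ρ ∷ σ₁₂ ∷ ρ ∷ σ₂₃ ∷ σ₁₂ ∷ ρ ∷ σ₁₂ ∷ σ₂₃ ∷ []) ∷ []) )
    ∷ ( ( (short , 121 , 010) ∷ (long , 011 , 122) ∷ [])
       ,
         ( cite 20 (ρ ∷ σ₂₃ ∷ σ₁₂ ∷ ρ ∷ σ₁₂ ∷ σ₂₃ ∷ σ₁₂ ∷ []) ∷ hex 011 122 112 010 121 012 ∷
           hex 110 012 112 010 121 111 ∷ cite 20 (ρ ∷ σ₁₂ ∷ []) ∷ []) )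
    ∷ ( ( (short , 211 , 122) ∷ [])
       ,
         ( cite 20 [] ∷ cite 20 (σ₂₃ ∷ []) ∷ cite 21 (σ₁₂ ∷ ρ ∷ σ₂₃ ∷ σ₁₂ ∷ ρ ∷ σ₁₂ ∷ σ₂₃ ∷ []) ∷
           cite 21 (σ₁₂ ∷ ρ ∷ σ₂₃ ∷ σ₁₂ ∷ ρ ∷ σ₂₃ ∷ []) ∷
           cite 20 (σ₂₃ ∷ σ₁₂ ∷ ρ ∷ σ₁₂ ∷ σ₂₃ ∷ σ₁₂ ∷ []) ∷
           cite 20 (σ₂₃ ∷ σ₁₂ ∷ ρ ∷ σ₂₃ ∷ σ₁₂ ∷ []) ∷ cite 21 (ρ ∷ σ₁₂ ∷ σ₂₃ ∷ σ₁₂ ∷ []) ∷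
           hex 110 122 112 210 211 201 ∷ cite 20 (σ₁₂ ∷ ρ ∷ σ₁₂ ∷ σ₂₃ ∷ σ₁₂ ∷ []) ∷
           hex 101 122 112 210 121 201 ∷ cite 20 (ρ ∷ σ₂₃ ∷ σ₁₂ ∷ ρ ∷ σ₂₃ ∷ []) ∷
           cite 21 (σ₁₂ ∷ ρ ∷ σ₂₃ ∷ σ₁₂ ∷ ρ ∷ σ₂₃ ∷ σ₁₂ ∷ []) ∷ hex 101 210 110 201 211 100 ∷
           hex 011 210 110 100 211 021 ∷ []) )
    ∷ [])

  -- Three images of the last lemma make the pairs 211-122, 121-212 and 112-221 long. They are the
  -- opposite pairs of a 6-cycle whose edges are the six other even-odd pairs, so every comparison
  -- in the hexad holds.
  final : List Step
  final =
    ( cite 22 [] ∷ cite 22 (σ₁₂ ∷ []) ∷ cite 22 (σ₂₃ ∷ σ₁₂ ∷ []) ∷ hex 112 221 121 212 211 122 ∷ [])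

  cube-not-PCG : ¬ IsIntervalPCG 1 Cube
  cube-not-PCG P = derives-sound [] lemmas final tt (PCGColouring.colouring P) []

-- Caterpillars

-- A rooted forest in terms of depth: neighbours differ by one in `rank`, and a vertex has at most
-- one neighbour of smaller rank, its parent.
module Ranked (G : Graph) (rank : Graph.V G → ℕ)
  (rank-adj : ∀ {x y} → Graph.Adj G x y → rank y ≡ suc (rank x) ⊎ rank x ≡ suc (rank y))
  (parent-unique : ∀ {x x′ y} → Graph.Adj G x y → Graph.Adj G x′ y →
    rank y ≡ suc (rank x) → rank y ≡ suc (rank x′) → x ≡ x′)
  where
  open Graph G
  open Paths G

  up : ∀ {m n} → n ≡ suc m → m ℕ.< n
  up refl = ℕ.n<1+n _

  -- A path that has gone up keeps going up: a downward step would lead back to the parent just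
  -- left.
  ascends : ∀ {x y z} (e : Adj x y) (p : Walk G y z) → Distinct (e ◅ p) →
    rank y ≡ suc (rank x) → rank x ℕ.< rank z
  ascends e ε _ eq = up eq
  ascends e (f ◅ p) u@(_ ∷ u′) eq with rank-adj f
  ... | inj₁ eq′ = ℕ.<-trans (up eq) (ascends f p u′ eq′)
  ... | inj₂ eq′ = ⊥-elim (start∉ {e = e} (f ◅ p) u
    (subst (_∈ vertices G (f ◅ p)) (sym (parent-unique e (symm f) eq eq′)) (there (start∈ p))))

  -- Once a path turns upwards it stays so and enters its end from the parent; otherwise it descends
  -- throughout.
  descends-or-parent : ∀ {x y z} (e : Adj x y) (p : Walk G y z) → Distinct (e ◅ p) →
    rank z ℕ.< rank x ⊎
    (Σ[ v ∈ V ] v ∈ vertices G (e ◅ p) × Adj v z × rank z ≡ suc (rank v))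
  descends-or-parent {x} e ε _ with rank-adj e
  ... | inj₁ eq = inj₂ (x , here refl , e , eq)
  ... | inj₂ eq = inj₁ (up eq)
  descends-or-parent {z = z} e (f ◅ p) u@(_ ∷ u′) with descends-or-parent f p u′
  ... | inj₂ (v , v∈p , a , eq) = inj₂ (v , there v∈p , a , eq)
  ... | inj₁ z<y with rank-adj e
  ...   | inj₁ eq = ⊥-elim (ℕ.<⇒≱ (ascends e (f ◅ p) u eq) (ℕ.≤-pred (subst (λ h → rank z ℕ.< h) eq z<y)))
  ...   | inj₂ eq = inj₁ (ℕ.<-trans z<y (up eq))

  -- The lower end of the closing edge is the parent of the higher end. The path uses the higher end
  -- either through that same parent, which it would then visit twice, or in a direction that
  -- contradicts the ranks.
  acyclic : Acyclic G
  acyclic (path ε _) (s≤s ()) _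
  acyclic (path (_ ◅ ε) _) (s≤s (s≤s ())) _
  acyclic (path (e ◅ f ◅ p) u@(_ ∷ u′)) _ a with rank-adj a
  acyclic (path (e ◅ f ◅ p) u@(_ ∷ u′)) _ a | inj₁ x≡1+z with rank-adj e
  ... | inj₁ eq = ℕ.<-asym (ascends e (f ◅ p) u eq) (up x≡1+z)
  ... | inj₂ eq = start∉ {e = f} p u′
    (subst (_∈ vertices G p) (parent-unique a (symm e) x≡1+z eq) (end∈ p))
  acyclic (path (e ◅ f ◅ p) u@(_ ∷ u′)) _ a | inj₂ z≡1+x with descends-or-parent f p u′
  ... | inj₂ (v , v∈p , b , eq) = start∉ {e = e} (f ◅ p) u
    (subst (_∈ vertices G (f ◅ p)) (parent-unique b (symm a) eq z≡1+x) v∈p)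
  ... | inj₁ z<y with rank-adj e
  ...   | inj₁ eq = ℕ.<-irrefl (trans z≡1+x (sym eq)) z<y
  ...   | inj₂ eq = ℕ.<-asym z<y (ℕ.<-trans (up eq) (up z≡1+x))

-- Integers among the reals

ι : ℤ → ℚ
ι i = mkℚ i 0 (Coprime.sym (Coprime.1-coprimeTo _))

ι-+ : ∀ i j → ι (i ℤ.+ j) ≡ ι i ℚ.+ ι j
ι-+ i j = ℚ.toℚᵘ-injective (ℚᵘ.≃-trans
  (*≡* (solve 2 (λ i j → (i :+ j) :* (con (+ 1) :* con (+ 1)) := (i :* con (+ 1) :+ j :* con (+ 1)) :* con (+ 1)) refl i j))
  (ℚᵘ.≃-sym (ℚ.toℚᵘ-homo-+ (ι i) (ι j))))
  where open ℤ-Solver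

ι-mono-≤ : ∀ {i j} → i ℤ.≤ j → ι i ℚ.≤ ι j
ι-mono-≤ i≤j = *≤* (ℤ.*-monoʳ-≤-nonNeg (+ 1) i≤j)

ι-pos : ∀ {i} → + 0 ℤ.< i → 0ℚ ℚ.< ι i
ι-pos 0<i = ℚ.<-≤-trans (ℚ.*<* (ℤ.+<+ (s≤s z≤n))) (ι-mono-≤ (ℤ.i<j⇒suc[i]≤j 0<i))

constant : ℤ → ℝ
constant i = mkℝ (λ _ → ι i) λ δ 0<δ → 0 , λ _ _ _ _ →
  subst (ℚ._≤ δ) (cong ℚ.∣_∣ (sym (ℚ.+-inverseʳ (ι i)))) (ℚ.<⇒≤ 0<δ)

infix 4 _≐_
-- Being constant, such reals inherit the decidable order of ℤ: `≐-≤⁻` recovers an integer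
-- inequality from the negatively defined `_≤ᴿ_`.
_≐_ : ℝ → ℤ → Set
r ≐ i = ∀ n → seq r n ≡ ι i

≐-≤ : ∀ {r s i j} → r ≐ i → s ≐ j → i ℤ.≤ j → r ≤ᴿ s
≐-≤ {r} {s} r≐i s≐j i≤j = ≲⇒≤ᴿ {r} {s} (≲-pointwise {r} {s}
  λ n → subst₂ ℚ._≤_ (sym (r≐i n)) (sym (s≐j n)) (ι-mono-≤ i≤j))

≐-< : ∀ {r s i j} → r ≐ i → s ≐ j → i ℤ.< j → r <ᴿ s
≐-< {i = i} r≐i s≐j i<j = ι (+ 1) , ι-pos (ℤ.+<+ (s≤s z≤n)) , 0 , λ n _ →
  subst₂ ℚ._≤_ (trans (ι-+ i (+ 1)) (cong (ℚ._+ ι (+ 1)) (sym (r≐i n)))) (sym (s≐j n))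
    (ι-mono-≤ (subst (ℤ._≤ _) (ℤ.+-comm (+ 1) i) (ℤ.i<j⇒suc[i]≤j i<j)))

≐-≤⁻ : ∀ {r s i j} → r ≐ i → s ≐ j → r ≤ᴿ s → i ℤ.≤ j
≐-≤⁻ {r} {s} {i} {j} r≐i s≐j r≤s = ℤ.≮⇒≥ λ j<i → r≤s (≐-< {s} {r} s≐j r≐i j<i)

≐-+ : ∀ {r s i j} → r ≐ i → s ≐ j → r +ᴿ s ≐ i ℤ.+ j
≐-+ {i = i} {j} r≐i s≐j n = trans (cong₂ ℚ._+_ (r≐i n) (s≐j n)) (sym (ι-+ i j))

∣m-n∣≡1 : ∀ m n → ℕ.∣ m - n ∣ ≡ 1 → n ≡ suc m ⊎ m ≡ suc n
∣m-n∣≡1 zero    n       eq = inj₁ eq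
∣m-n∣≡1 (suc m) zero    eq = inj₂ eq
∣m-n∣≡1 (suc m) (suc n) eq with ∣m-n∣≡1 m n eq
... | inj₁ e = inj₁ (cong suc e)
... | inj₂ e = inj₂ (cong suc e)

∣1+n-n∣≡1 : ∀ n → ℕ.∣ suc n - n ∣ ≡ 1
∣1+n-n∣≡1 zero    = refl
∣1+n-n∣≡1 (suc n) = ∣1+n-n∣≡1 n

∣n-1+n∣≡1 : ∀ n → ℕ.∣ n - suc n ∣ ≡ 1
∣n-1+n∣≡1 zero    = refl
∣n-1+n∣≡1 (suc n) = ∣n-1+n∣≡1 n

-- One step along the spine; the bound by the maximum keeps the new position on it.
towards : ∀ m n {k} → ℕ.∣ m - n ∣ ≡ suc k →
  ∃[ m′ ] (ℕ.∣ m - m′ ∣ ≡ 1 × ℕ.∣ m′ - n ∣ ≡ k × m′ ℕ.≤ m ℕ.⊔ n)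
towards zero    (suc n) refl = 1 , refl , refl , s≤s z≤n
towards (suc m) zero    refl = m , ∣1+n-n∣≡1 m , ℕ.∣-∣-identityʳ m , ℕ.n≤1+n m
towards (suc m) (suc n) eq   with towards m n eq
... | m′ , d , e , le = suc m′ , d , e , s≤s le

≃ᴿ-refl : ∀ {r} → r ≃ᴿ r
≃ᴿ-refl {r} = le , le
  where
  le : r ≤ᴿ r
  le = ≲⇒≤ᴿ {r} {r} (≲-pointwise {r} {r} λ _ → ℚ.≤-refl)

-- Spine edges have weight 1, so lengths along the spine are differences of positions. Since `first`
-- and `last` hang from its two distinct ends, every spine vertex has two neighbours, and the leaves
-- are exactly the pendant vertices.
module Caterpillar {L : Set} {N : ℕ} (L↔ : L ↔ Fin N) (P : ℕ) (1≤P : 1 ℕ.≤ P)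
  (pos : L → Fin (suc P)) (w : L → ℤ) (w-pos : ∀ u → + 0 ℤ.< w u)
  (first last : L) (pos-first : toℕ (pos first) ≡ 0) (pos-last : toℕ (pos last) ≡ P)
  where

  Vertex : Set
  Vertex = Fin (suc P) ⊎ L

  infix 4 _∼_
  _∼_ : Vertex → Vertex → Set
  inj₁ i ∼ inj₁ j = DifferByOne i j
  inj₁ i ∼ inj₂ u = i ≡ pos u
  inj₂ u ∼ inj₁ i = i ≡ pos u
  inj₂ _ ∼ inj₂ _ = ⊥

  ∼? : Decidable _∼_
  ∼? (inj₁ i) (inj₁ j) = ℕ.∣ toℕ i - toℕ j ∣ ℕ.≟ 1
  ∼? (inj₁ i) (inj₂ u) = i ≟ᶠ pos u
  ∼? (inj₂ u) (inj₁ i) = i ≟ᶠ pos u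
  ∼? (inj₂ _) (inj₂ _) = no λ ()

  ∼-sym : Symmetric _∼_
  ∼-sym {inj₁ i} {inj₁ j} e = trans (ℕ.∣-∣-comm (toℕ j) (toℕ i)) e
  ∼-sym {inj₁ _} {inj₂ _} e = e
  ∼-sym {inj₂ _} {inj₁ _} e = e

  ∼-irrefl : Irreflexive _≡_ _∼_
  ∼-irrefl {inj₁ i} refl e with () ← trans (sym (ℕ.∣n-n∣≡0 (toℕ i))) e
  ∼-irrefl {inj₂ _} refl ()

  graph : Graph
  graph = record
    { V        = Vertex
    ; order    = suc P ℕ.+ N
    ; finite   = ↔-sym +↔⊎ ↔-∘ (↔-id _ ⊎-↔ L↔)
    ; nonEmpty = inj₁ Fin.zero
    ; Adj      = _∼_
    ; adj?     = ∼?
    ; symm     = λ {x} {y} → ∼-sym {x} {y}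
    ; irrefl   = ∼-irrefl
    }

  open Paths graph

  rank : Vertex → ℕ
  rank (inj₁ i) = toℕ i
  rank (inj₂ u) = suc (toℕ (pos u))

  rank-adj : ∀ {x y} → x ∼ y → rank y ≡ suc (rank x) ⊎ rank x ≡ suc (rank y)
  rank-adj {inj₁ i} {inj₁ j} e    = ∣m-n∣≡1 (toℕ i) (toℕ j) e
  rank-adj {inj₁ _} {inj₂ _} refl = inj₁ refl
  rank-adj {inj₂ _} {inj₁ _} refl = inj₂ refl

  parent-unique : ∀ {x x′ y} → x ∼ y → x′ ∼ y →
    rank y ≡ suc (rank x) → rank y ≡ suc (rank x′) → x ≡ x′
  parent-unique {inj₁ i} {inj₁ j} {inj₁ _} _ _ p q =
    cong inj₁ (toℕ-injective (ℕ.suc-injective (trans (sym p) q)))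
  parent-unique {inj₂ _} {_}      {inj₁ _} refl _ p _ = ⊥-elim (ℕ.m≢1+n+m _ {1} p)
  parent-unique {inj₁ _} {inj₂ _} {inj₁ _} _ refl _ q = ⊥-elim (ℕ.m≢1+n+m _ {1} q)
  parent-unique {inj₁ _} {inj₁ _} {inj₂ _} e f _ _ = cong inj₁ (trans e (sym f))

  open Ranked graph rank (λ {x} {y} → rank-adj {x} {y}) (λ {x} {x′} {y} → parent-unique {x} {x′} {y})
    using (acyclic)

  weight : Vertex → Vertex → ℝ
  weight (inj₁ _) (inj₂ u) = constant (w u)
  weight (inj₂ u) (inj₁ _) = constant (w u)
  weight _        _        = constant (+ 1)

  weight-sym : ∀ {x y} → x ∼ y → weight x y ≃ᴿ weight y x
  weight-sym {inj₁ _} {inj₁ _} _ = ≃ᴿ-refl {constant (+ 1)}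
  weight-sym {inj₁ _} {inj₂ u} _ = ≃ᴿ-refl {constant (w u)}
  weight-sym {inj₂ u} {inj₁ _} _ = ≃ᴿ-refl {constant (w u)}

  0ᴿ≐0 : 0ᴿ ≐ + 0
  0ᴿ≐0 _ = refl

  constant-≐ : ∀ i → constant i ≐ i
  constant-≐ _ _ = refl

  weight-pos : ∀ {x y} → x ∼ y → 0ᴿ <ᴿ weight x y
  weight-pos {inj₁ _} {inj₁ _} _ = ≐-< {0ᴿ} {constant (+ 1)} 0ᴿ≐0 (constant-≐ (+ 1)) (ℤ.+<+ (s≤s z≤n))
  weight-pos {inj₁ _} {inj₂ u} _ = ≐-< {0ᴿ} {constant (w u)} 0ᴿ≐0 (constant-≐ (w u)) (w-pos u)
  weight-pos {inj₂ u} {inj₁ _} _ = ≐-< {0ᴿ} {constant (w u)} 0ᴿ≐0 (constant-≐ (w u)) (w-pos u)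

  -- The same sum as `totalWeight`, available before the tree is assembled: the paths in `connected`
  -- are built together with their lengths.
  total : ∀ {x y} → Walk graph x y → ℝ
  total ε                   = 0ᴿ
  total (_◅_ {x} {y} _ p) = weight x y +ᴿ total p

  anchor : Vertex → Fin (suc P)
  anchor (inj₁ i) = i
  anchor (inj₂ u) = pos u

  tail : Vertex → ℤ
  tail (inj₁ _) = + 0
  tail (inj₂ u) = w u

  -- `near` is the invariant behind distinctness: the walk stays within `k` of the anchor of `y`,
  -- while a new first vertex lies at distance `suc k` from it.
  record Approach (i : Fin (suc P)) (y : Vertex) (k : ℕ) : Set where
    field
      walk     : Walk graph (inj₁ i) y
      distinct : Distinct walk
      near     : ∀ {j} → inj₁ j ∈ vertices graph walk → ℕ.∣ toℕ j - toℕ (anchor y) ∣ ℕ.≤ k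
      pendant  : ∀ {u} → inj₂ u ∈ vertices graph walk → inj₂ u ≡ y
      total-≐  : total walk ≐ + k ℤ.+ tail y

  open Approach

  approach : ∀ k i y → ℕ.∣ toℕ i - toℕ (anchor y) ∣ ≡ k → Approach i y k
  approach zero i (inj₁ j) eq with toℕ-injective (ℕ.∣m-n∣≡0⇒m≡n {toℕ i} {toℕ j} eq)
  ... | refl = record
    { walk     = ε
    ; distinct = [] ∷ []
    ; near     = λ { (here refl) → ℕ.≤-reflexive eq }
    ; pendant  = λ { (here ()) }
    ; total-≐  = 0ᴿ≐0
    }
  approach zero i (inj₂ u) eq with toℕ-injective (ℕ.∣m-n∣≡0⇒m≡n {toℕ i} {toℕ (pos u)} eq)
  ... | refl = record
    { walk     = refl ◅ ε
    ; distinct = ((λ ()) ∷ []) ∷ [] ∷ []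
    ; near     = λ { (here refl) → ℕ.≤-reflexive eq ; (there (here ())) }
    ; pendant  = λ { (here ()) ; (there (here refl)) → refl }
    ; total-≐  = subst (constant (w u) +ᴿ 0ᴿ ≐_) (ℤ.+-comm (w u) (+ 0))
        (≐-+ {constant (w u)} {0ᴿ} (constant-≐ (w u)) 0ᴿ≐0)
    }
  approach (suc k) i y eq with towards (toℕ i) (toℕ (anchor y)) eq
  ... | m , d , e , m≤ = record
    { walk     = step ◅ walk r
    ; distinct = ◅-distinct step (walk r) (λ i∈r → ℕ.<-irrefl refl (subst (ℕ._≤ k) eq (near r i∈r))) (distinct r)
    ; near     = λ { (here refl) → ℕ.≤-reflexive eq ; (there j∈r) → ℕ.m≤n⇒m≤1+n (near r j∈r) }
    ; pendant  = λ { (here ()) ; (there u∈r) → pendant r u∈r }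
    ; total-≐  = subst (constant (+ 1) +ᴿ total (walk r) ≐_) (sym (ℤ.+-assoc (+ 1) (+ k) (tail y)))
        (≐-+ {constant (+ 1)} {total (walk r)} (constant-≐ (+ 1)) (total-≐ r))
    }
    where
    m<1+P : m ℕ.< suc P
    m<1+P = ℕ.≤-<-trans m≤ (ℕ.⊔-lub (toℕ<n i) (toℕ<n (anchor y)))

    next : Fin (suc P)
    next = fromℕ< m<1+P

    step : DifferByOne i next
    step = trans (cong (λ h → ℕ.∣ toℕ i - h ∣) (toℕ-fromℕ< m<1+P)) d

    r : Approach next y k
    r = approach k next y (trans (cong (λ h → ℕ.∣ h - toℕ (anchor y) ∣) (toℕ-fromℕ< m<1+P)) e)

  _≟ᵁ_ : DecidableEquality L
  _≟ᵁ_ = inj⇒≟ (↔⇒↣ L↔)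

  toAnchor : ∀ u y → Approach (pos u) y ℕ.∣ toℕ (pos u) - toℕ (anchor y) ∣
  toAnchor u y = approach _ (pos u) y refl

  fromPendant : ∀ u y → inj₂ u ≢ y → Path graph (inj₂ u) y
  fromPendant u y u≢y = path (refl ◅ walk (toAnchor u y))
    (◅-distinct refl (walk (toAnchor u y)) (u≢y ∘ pendant (toAnchor u y)) (distinct (toAnchor u y)))

  connected : Connected graph
  connected (inj₁ i) y = path (walk (approach _ i y refl)) (distinct (approach _ i y refl))
  connected (inj₂ u) (inj₁ j) = fromPendant u (inj₁ j) λ ()
  connected (inj₂ u) (inj₂ v) with u ≟ᵁ v
  ... | yes refl = path ε ([] ∷ [])
  ... | no u≢v   = fromPendant u (inj₂ v) λ { refl → u≢v refl }

  tree : WeightedTree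
  tree = record
    { graph      = graph
    ; connected  = connected
    ; acyclic    = acyclic
    ; weight     = weight
    ; weight-sym = λ {x} {y} → weight-sym {x} {y}
    ; weight-pos = λ {x} {y} → weight-pos {x} {y}
    }

  open WeightedTree tree using (dist; totalWeight)

  totalWeight-≐ : ∀ {x y i} (p : Walk graph x y) → total p ≐ i → totalWeight p ≐ i
  totalWeight-≐ p h n = trans (same p n) (h n)
    where
    same : ∀ {x y} (p : Walk graph x y) n → seq (totalWeight p) n ≡ seq (total p) n
    same ε                 n = refl
    same (_◅_ {x} {y} _ p) n = cong (seq (weight x y) n ℚ.+_) (same p n)

  dist-≐ : ∀ {u v} → u ≢ v →
    dist (inj₂ u) (inj₂ v) ≐ w u ℤ.+ (+ ℕ.∣ toℕ (pos u) - toℕ (pos v) ∣ ℤ.+ w v)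
  dist-≐ {u} {v} u≢v with u ≟ᵁ v
  ... | yes u≡v = ⊥-elim (u≢v u≡v)
  ... | no _    = totalWeight-≐ {inj₂ u} (refl ◅ walk (toAnchor u (inj₂ v)))
    (≐-+ {constant (w u)} {total (walk (toAnchor u (inj₂ v)))} (constant-≐ (w u)) (total-≐ (toAnchor u (inj₂ v))))

  spine-neighbour : ∀ i m → m ℕ.< suc P → ℕ.∣ toℕ i - m ∣ ≡ 1 → Σ[ j ∈ Fin (suc P) ] inj₁ i ∼ inj₁ j × toℕ j ≡ m
  spine-neighbour i m m<1+P d = fromℕ< m<1+P ,
    trans (cong (λ h → ℕ.∣ toℕ i - h ∣) (toℕ-fromℕ< m<1+P)) d , toℕ-fromℕ< m<1+P

  two-neighbours : ∀ i → Σ[ y ∈ Vertex ] Σ[ z ∈ Vertex ] inj₁ i ∼ y × inj₁ i ∼ z × y ≢ z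
  two-neighbours i with toℕ i in eq
  ... | zero with spine-neighbour i 1 (s≤s 1≤P) (cong (λ h → ℕ.∣ h - 1 ∣) eq)
  ...   | j , e , _ = inj₁ j , inj₂ first , e , toℕ-injective (trans eq (sym pos-first)) , λ ()
  two-neighbours i | suc m
    with spine-neighbour i m (ℕ.<-trans (ℕ.n<1+n m) (subst (ℕ._< suc P) eq (toℕ<n i)))
      (trans (cong (λ h → ℕ.∣ h - m ∣) eq) (∣1+n-n∣≡1 m))
  ... | j , e , j≡m with suc m ℕ.≟ P
  ...   | yes 1+m≡P = inj₁ j , inj₂ last , e , toℕ-injective (trans eq (trans 1+m≡P (sym pos-last))) , λ ()
  ...   | no 1+m≢P with spine-neighbour i (suc (suc m))
      (s≤s (ℕ.≤∧≢⇒< (ℕ.≤-pred (subst (ℕ._< suc P) eq (toℕ<n i))) 1+m≢P))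
      (trans (cong (λ h → ℕ.∣ h - suc (suc m) ∣) eq) (∣n-1+n∣≡1 (suc m)))
  ...     | k , f , k≡2+m = inj₁ j , inj₁ k , e , f ,
    λ { refl → ℕ.m≢1+n+m m {1} (trans (sym j≡m) k≡2+m) }

  leaf⇔ : ∀ x → Leaf graph x ⇔ (∃[ u ] inj₂ u ≡ x)
  leaf⇔ x = mk⇔ (to x) from
    where
    to : ∀ x → Leaf graph x → ∃[ u ] inj₂ u ≡ x
    to (inj₂ u) _ = u , refl
    to (inj₁ i) (inj₂ single) with () ← single (inj₂ first)
    to (inj₁ i) (inj₁ (_ , _ , unique)) with two-neighbours i
    ... | y , z , e , f , y≢z = ⊥-elim (y≢z (trans (sym (unique e)) (unique f)))

    from : ∀ {x} → ∃[ u ] inj₂ u ≡ x → Leaf graph x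
    from (u , refl) = inj₁ (inj₁ (pos u) , refl , λ { {inj₁ _} e → cong inj₁ (sym e) })

-- Integer estimates that single out the unit vectors

module Arithmetic where
  open import Data.Integer.Base hiding (_⊖_)
  open import Data.Integer.Properties
  open ℤ-Solver

  infixr 6 _⊕_
  _⊕_ : ∀ {i j} → 0ℤ ≤ i → 0ℤ ≤ j → 0ℤ ≤ i + j
  _⊕_ = +-mono-≤

  infixr 7 _⊗_
  _⊗_ : ∀ {i j} → 0ℤ ≤ i → 0ℤ ≤ j → 0ℤ ≤ i * j
  _⊗_ {+ m} {+ n} _ _ = subst (0ℤ ≤_) (pos-* m n) (+≤+ ℕ.z≤n)

  0≤+ : ∀ {n} → 0ℤ ≤ + n
  0≤+ = +≤+ ℕ.z≤n

  diff : ∀ {i j} → i ≤ j → 0ℤ ≤ j - i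
  diff = i≤j⇒0≤j-i

  diff-< : ∀ {i j} → i < j → 0ℤ ≤ j - i - 1ℤ
  diff-< {i} {j} i<j = subst (0ℤ ≤_) (solve 2 (λ i j → j :- (con 1ℤ :+ i) := j :- i :- con 1ℤ) refl i j)
    (diff (i<j⇒suc[i]≤j i<j))

  ≤-from : ∀ {s i j} → 0ℤ ≤ s → s ≡ j - i → i ≤ j
  ≤-from 0≤s eq = 0≤i-j⇒j≤i (subst (0ℤ ≤_) eq 0≤s)

  <-from : ∀ {s i j} → 0ℤ ≤ s → s ≡ j - i - 1ℤ → i < j
  <-from {s} {i} {j} 0≤s eq = suc[i]≤j⇒i<j (≤-from 0≤s
    (trans eq (solve 2 (λ i j → j :- i :- con 1ℤ := j :- (con 1ℤ :+ i)) refl i j)))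

  -- Refutations are given as certificates: a sum of products of nonnegative quantities that the
  -- solver evaluates to a negative constant.
  absurd : ∀ {s n} → 0ℤ ≤ s → s ≡ -[1+ n ] → ⊥
  absurd 0≤s refl with () ← 0≤s

  -- The spine positions grow by K per unit of x + y + z, and M dominates the
  -- remaining contributions to a distance.
  K : ℤ → ℤ
  K X = + 4 * X + + 6

  M : ℤ → ℤ → ℤ
  M X P = P + + 8 * X + + 10

  -- The window for the sign `η` after subtraction of C₀ + C₁ + `η` M. Here `ℓ` stands for c - a - b
  -- and `A` for the distance along the spine.
  Target : (X P η a ℓ A : ℤ) → Set
  Target X P η a ℓ A =
    (K X - η - + 2 ≤ M X P * (ℓ - η) + + 4 * a + A) × (M X P * (ℓ - η) + + 4 * a + A ≤ K X - η + + 2)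

  AbsOf : ℤ → ℤ → Set
  AbsOf i A = A ≡ i ⊎ A ≡ - i

  UnitVector : ℤ → ℤ → ℤ → Set
  UnitVector a b c =
      (∣ a ∣ ≡ 1 × b ≡ 0ℤ × c ≡ 0ℤ)
    ⊎ (a ≡ 0ℤ × ∣ b ∣ ≡ 1 × c ≡ 0ℤ)
    ⊎ (a ≡ 0ℤ × b ≡ 0ℤ × ∣ c ∣ ≡ 1)

  pin : ∀ a → - + 3 ≤ + 4 * a → + 4 * a ≤ + 3 → a ≡ 0ℤ
  pin a lo hi with <-cmp a 0ℤ
  ... | tri≈ _ a≡0 _ = a≡0
  ... | tri< a<0 _ _ = ⊥-elim (absurd {n = 0} (diff lo ⊕ 0≤+ {4} ⊗ diff-< a<0)
    (solve 1 (λ a → (con (+ 4) :* a :- con (- + 3)) :+ con (+ 4) :* (con 0ℤ :- a :- con 1ℤ) := con (- 1ℤ)) refl a))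
  ... | tri> _ _ 0<a = ⊥-elim (absurd {n = 0} (diff hi ⊕ 0≤+ {4} ⊗ diff-< 0<a)
    (solve 1 (λ a → (con (+ 3) :- con (+ 4) :* a) :+ con (+ 4) :* (a :- con 0ℤ :- con 1ℤ) := con (- 1ℤ)) refl a))

  pin⁺ : ∀ a → - + 3 ≤ + 4 * a → + 4 * a ≤ + 7 → a ≡ 0ℤ ⊎ a ≡ 1ℤ
  pin⁺ a lo hi with <-cmp a 1ℤ
  ... | tri≈ _ a≡1 _ = inj₂ a≡1
  ... | tri< a<1 _ _ = inj₁ (pin a lo (≤-from (0≤+ {4} ⊗ diff-< a<1 ⊕ 0≤+ {3})
    (solve 1 (λ a → con (+ 4) :* (con 1ℤ :- a :- con 1ℤ) :+ con (+ 3) := con (+ 3) :- con (+ 4) :* a) refl a)))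
  ... | tri> _ _ 1<a = ⊥-elim (absurd {n = 0} (diff hi ⊕ 0≤+ {4} ⊗ diff-< 1<a)
    (solve 1 (λ a → (con (+ 7) :- con (+ 4) :* a) :+ con (+ 4) :* (a :- con 1ℤ :- con 1ℤ) := con (- 1ℤ)) refl a))

  pin⁻ : ∀ a → - + 7 ≤ + 4 * a → + 4 * a ≤ + 3 → a ≡ 0ℤ ⊎ a ≡ - 1ℤ
  pin⁻ a lo hi with pin⁺ (- a)
      (≤-from (diff hi) (solve 1 (λ a → con (+ 3) :- con (+ 4) :* a := con (+ 4) :* (:- a) :- con (- + 3)) refl a))
      (≤-from (diff lo) (solve 1 (λ a → con (+ 4) :* a :- con (- + 7) := con (+ 7) :- con (+ 4) :* (:- a)) refl a))
  ... | inj₁ eq = inj₁ (trans (sym (neg-involutive a)) (cong -_ eq))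
  ... | inj₂ eq = inj₂ (trans (sym (neg-involutive a)) (cong -_ eq))

  -- Since |a| ≤ X and 0 ≤ A ≤ P, a nonzero multiple of M would leave the window, so `ℓ` is `η`. As
  -- |4 a| ≤ 4 X < K, the value A = 1 at `t = 0` is too small, and |t| ≥ 2 makes A too large;
  -- `t = ± 1` turns the window into bounds on 4 a.
  locate : ∀ X P t ℓ a A η → 0ℤ ≤ X → - X ≤ a → a ≤ X → 0ℤ ≤ A → A ≤ P →
    AbsOf (K X * t - 1ℤ) A → - 1ℤ ≤ η → η ≤ 1ℤ → Target X P η a ℓ A →
    ℓ ≡ η × ( (t ≡ 1ℤ × - η - 1ℤ ≤ + 4 * a × + 4 * a ≤ + 3 - η)
            ⊎ (t ≡ - 1ℤ × - η - + 3 ≤ + 4 * a × + 4 * a ≤ 1ℤ - η))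
  locate X P t ℓ a A η 0≤X -X≤a a≤X 0≤A A≤P abs -1≤η η≤1 (lo , hi) with <-cmp ℓ η
  ... | tri< ℓ<η _ _ = ⊥-elim (absurd {n = 12}
    (diff lo ⊕ (0≤P ⊕ 0≤+ {8} ⊗ 0≤X ⊕ 0≤+ {10}) ⊗ diff-< ℓ<η ⊕ 0≤+ {4} ⊗ diff a≤X ⊕ diff A≤P ⊕ diff η≤1 ⊕ 0≤+ {8} ⊗ 0≤X)
    (solve 6 (λ X P ℓ a A η → let M = P :+ con (+ 8) :* X :+ con (+ 10) ; K = con (+ 4) :* X :+ con (+ 6) in
      (M :* (ℓ :- η) :+ con (+ 4) :* a :+ A :- (K :- η :- con (+ 2))) :+
      ((P :+ (con (+ 8) :* X :+ con (+ 10))) :* (η :- ℓ :- con 1ℤ) :+ (con (+ 4) :* (X :- a) :+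
      ((P :- A) :+ ((con 1ℤ :- η) :+ con (+ 8) :* X)))) := con (- + 13)) refl X P ℓ a A η))
    where 0≤P = ≤-trans 0≤A A≤P
  ... | tri> _ _ η<ℓ = ⊥-elim (absurd {n = 0}
    (diff hi ⊕ (0≤P ⊕ 0≤+ {8} ⊗ 0≤X ⊕ 0≤+ {10}) ⊗ diff-< η<ℓ ⊕ 0≤+ {4} ⊗ diff -X≤a ⊕ 0≤A ⊕ diff -1≤η ⊕ 0≤P)
    (solve 6 (λ X P ℓ a A η → let M = P :+ con (+ 8) :* X :+ con (+ 10) ; K = con (+ 4) :* X :+ con (+ 6) in
      ((K :- η :+ con (+ 2)) :- (M :* (ℓ :- η) :+ con (+ 4) :* a :+ A)) :+
      ((P :+ (con (+ 8) :* X :+ con (+ 10))) :* (ℓ :- η :- con 1ℤ) :+ (con (+ 4) :* (a :- (:- X)) :+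
      (A :+ ((η :- con (- 1ℤ)) :+ P)))) := con (- 1ℤ)) refl X P ℓ a A η))
    where 0≤P = ≤-trans 0≤A A≤P
  ... | tri≈ _ refl _ = refl , by-t abs
    where
    lo′ : 0ℤ ≤ + 4 * a + A - (K X - η - + 2)
    lo′ = subst (0ℤ ≤_) (solve 5 (λ X P a A η → let M = P :+ con (+ 8) :* X :+ con (+ 10) ; K = con (+ 4) :* X :+ con (+ 6) in
      (M :* (η :- η) :+ con (+ 4) :* a :+ A :- (K :- η :- con (+ 2))) := con (+ 4) :* a :+ A :- (K :- η :- con (+ 2))) refl X P a A η) (diff lo)

    hi′ : 0ℤ ≤ K X - η + + 2 - (+ 4 * a + A)
    hi′ = subst (0ℤ ≤_) (solve 5 (λ X P a A η → let M = P :+ con (+ 8) :* X :+ con (+ 10) ; K = con (+ 4) :* X :+ con (+ 6) in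
      (K :- η :+ con (+ 2) :- (M :* (η :- η) :+ con (+ 4) :* a :+ A)) := K :- η :+ con (+ 2) :- (con (+ 4) :* a :+ A)) refl X P a A η) (diff hi)

    0≤K : 0ℤ ≤ + 4 * X + + 6
    0≤K = 0≤+ {4} ⊗ 0≤X ⊕ 0≤+ {6}

    by-t : AbsOf (K X * t - 1ℤ) A →
      (t ≡ 1ℤ × - η - 1ℤ ≤ + 4 * a × + 4 * a ≤ + 3 - η) ⊎ (t ≡ - 1ℤ × - η - + 3 ≤ + 4 * a × + 4 * a ≤ 1ℤ - η)
    by-t (inj₁ refl) with <-cmp t 1ℤ
    ... | tri≈ _ refl _ = inj₁ (refl ,
      ≤-from lo′ (solve 3 (λ X a η → let K = con (+ 4) :* X :+ con (+ 6) in
        con (+ 4) :* a :+ (K :* con 1ℤ :- con 1ℤ) :- (K :- η :- con (+ 2)) := con (+ 4) :* a :- (:- η :- con 1ℤ)) refl X a η) ,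
      ≤-from hi′ (solve 3 (λ X a η → let K = con (+ 4) :* X :+ con (+ 6) in
        K :- η :+ con (+ 2) :- (con (+ 4) :* a :+ (K :* con 1ℤ :- con 1ℤ)) := con (+ 3) :- η :- con (+ 4) :* a) refl X a η))
    ... | tri< t<1 _ _ = ⊥-elim (absurd {n = 0} (0≤A ⊕ 0≤K ⊗ diff-< t<1)
      (solve 2 (λ X t → let K = con (+ 4) :* X :+ con (+ 6) in
        (K :* t :- con 1ℤ) :+ K :* (con 1ℤ :- t :- con 1ℤ) := con (- 1ℤ)) refl X t))
    ... | tri> _ _ 1<t = ⊥-elim (absurd {n = 1} (hi′ ⊕ 0≤K ⊗ diff-< 1<t ⊕ 0≤+ {4} ⊗ diff -X≤a ⊕ diff -1≤η)
      (solve 4 (λ X t a η → let K = con (+ 4) :* X :+ con (+ 6) in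
        (K :- η :+ con (+ 2) :- (con (+ 4) :* a :+ (K :* t :- con 1ℤ))) :+ (K :* (t :- con 1ℤ :- con 1ℤ) :+
        (con (+ 4) :* (a :- (:- X)) :+ (η :- con (- 1ℤ)))) := con (- + 2)) refl X t a η))
    by-t (inj₂ refl) with <-cmp t (- 1ℤ)
    ... | tri≈ _ refl _ = inj₂ (refl ,
      ≤-from lo′ (solve 3 (λ X a η → let K = con (+ 4) :* X :+ con (+ 6) in
        con (+ 4) :* a :+ (:- (K :* con (- 1ℤ) :- con 1ℤ)) :- (K :- η :- con (+ 2)) := con (+ 4) :* a :- (:- η :- con (+ 3))) refl X a η) ,
      ≤-from hi′ (solve 3 (λ X a η → let K = con (+ 4) :* X :+ con (+ 6) in
        K :- η :+ con (+ 2) :- (con (+ 4) :* a :+ (:- (K :* con (- 1ℤ) :- con 1ℤ))) := con 1ℤ :- η :- con (+ 4) :* a) refl X a η))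
    ... | tri< t<-1 _ _ = ⊥-elim (absurd {n = 3} (hi′ ⊕ 0≤K ⊗ diff-< t<-1 ⊕ 0≤+ {4} ⊗ diff -X≤a ⊕ diff -1≤η)
      (solve 4 (λ X t a η → let K = con (+ 4) :* X :+ con (+ 6) in
        (K :- η :+ con (+ 2) :- (con (+ 4) :* a :+ (:- (K :* t :- con 1ℤ)))) :+ (K :* (con (- 1ℤ) :- t :- con 1ℤ) :+
        (con (+ 4) :* (a :- (:- X)) :+ (η :- con (- 1ℤ)))) := con (- + 4)) refl X t a η))
    ... | tri> _ _ -1<t with <-cmp t 0ℤ
    ...   | tri< t<0 _ _ = ⊥-elim (absurd {n = 0} (diff-< t<0 ⊕ diff-< -1<t)
      (solve 1 (λ t → (con 0ℤ :- t :- con 1ℤ) :+ (t :- con (- 1ℤ) :- con 1ℤ) := con (- 1ℤ)) refl t))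
    ...   | tri≈ _ refl _ = ⊥-elim (absurd {n = 1} (lo′ ⊕ 0≤+ {4} ⊗ diff a≤X ⊕ diff η≤1)
      (solve 3 (λ X a η → let K = con (+ 4) :* X :+ con (+ 6) in
        (con (+ 4) :* a :+ (:- (K :* con 0ℤ :- con 1ℤ)) :- (K :- η :- con (+ 2))) :+
        (con (+ 4) :* (X :- a) :+ (con 1ℤ :- η)) := con (- + 2)) refl X a η))
    ...   | tri> _ _ 0<t = ⊥-elim (absurd {n = 4} (0≤A ⊕ 0≤K ⊗ diff-< 0<t ⊕ 0≤+ {4} ⊗ 0≤X)
      (solve 2 (λ X t → let K = con (+ 4) :* X :+ con (+ 6) in
        (:- (K :* t :- con 1ℤ)) :+ (K :* (t :- con 0ℤ :- con 1ℤ) :+ con (+ 4) :* X) := con (- + 5)) refl X t))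

  -- Because 2 c = t + ℓ, the values of `t` and `ℓ` determine `c`, and together with `a` also `b`.
  solve-bc : ∀ a b c {t ℓ} c₀ → a + b + c ≡ t → c - a - b ≡ ℓ → t + ℓ ≡ c₀ * + 2 → c ≡ c₀ × b ≡ t - a - c₀
  solve-bc a b c c₀ refl refl eq with *-cancelʳ-≡ c c₀ (+ 2)
    (trans (solve 3 (λ a b c → c :* con (+ 2) := a :+ b :+ c :+ (c :- a :- b)) refl a b c) eq)
  ... | refl = refl , solve 3 (λ a b c → b := a :+ b :+ c :- a :- c) refl a b c

  Sign : ℤ → Set
  Sign η = η ≡ 1ℤ ⊎ η ≡ - 1ℤ

  sign-bounds : ∀ {η} → Sign η → - 1ℤ ≤ η × η ≤ 1ℤ
  sign-bounds (inj₁ refl) = -≤+ , ≤-refl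
  sign-bounds (inj₂ refl) = ≤-refl , -≤+

  target⇒unit : ∀ X P a b c A η → Sign η → 0ℤ ≤ X → - X ≤ a → a ≤ X → 0ℤ ≤ A → A ≤ P →
    AbsOf (K X * (a + b + c) - 1ℤ) A → Target X P η a (c - a - b) A → UnitVector a b c
  target⇒unit X P a b c A η s 0≤X -X≤a a≤X 0≤A A≤P abs tg
    with locate X P (a + b + c) (c - a - b) a A η 0≤X -X≤a a≤X 0≤A A≤P abs
      (proj₁ (sign-bounds s)) (proj₂ (sign-bounds s)) tg
  target⇒unit X P a b c A _ (inj₁ refl) 0≤X -X≤a a≤X 0≤A A≤P abs tg | l , inj₁ (t , lo , hi)
    with pin a (≤-trans (-≤- (ℕ.s≤s ℕ.z≤n)) lo) (≤-trans hi (+≤+ (ℕ.s≤s (ℕ.s≤s ℕ.z≤n))))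
  ... | refl with solve-bc a b c 1ℤ t l refl
  ...   | refl , refl = inj₂ (inj₂ (refl , refl , refl))
  target⇒unit X P a b c A _ (inj₁ refl) 0≤X -X≤a a≤X 0≤A A≤P abs tg | l , inj₂ (t , lo , hi)
    with pin⁻ a (≤-trans (-≤- (ℕ.s≤s (ℕ.s≤s (ℕ.s≤s ℕ.z≤n)))) lo) (≤-trans hi (+≤+ ℕ.z≤n))
  ... | inj₁ refl with solve-bc a b c 0ℤ t l refl
  ...   | refl , refl = inj₂ (inj₁ (refl , refl , refl))
  target⇒unit X P a b c A _ (inj₁ refl) 0≤X -X≤a a≤X 0≤A A≤P abs tg | l , inj₂ (t , lo , hi)
      | inj₂ refl with solve-bc a b c 0ℤ t l refl
  ...   | refl , refl = inj₁ (refl , refl , refl)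
  target⇒unit X P a b c A _ (inj₂ refl) 0≤X -X≤a a≤X 0≤A A≤P abs tg | l , inj₁ (t , lo , hi)
    with pin⁺ a (≤-trans -≤+ lo) (≤-trans hi (+≤+ (ℕ.s≤s (ℕ.s≤s (ℕ.s≤s (ℕ.s≤s ℕ.z≤n))))))
  ... | inj₁ refl with solve-bc a b c 0ℤ t l refl
  ...   | refl , refl = inj₂ (inj₁ (refl , refl , refl))
  target⇒unit X P a b c A _ (inj₂ refl) 0≤X -X≤a a≤X 0≤A A≤P abs tg | l , inj₁ (t , lo , hi)
      | inj₂ refl with solve-bc a b c 0ℤ t l refl
  ...   | refl , refl = inj₁ (refl , refl , refl)
  target⇒unit X P a b c A _ (inj₂ refl) 0≤X -X≤a a≤X 0≤A A≤P abs tg | l , inj₂ (t , lo , hi)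
    with pin a (≤-trans (-≤- (ℕ.s≤s ℕ.z≤n)) lo) (≤-trans hi (+≤+ (ℕ.s≤s (ℕ.s≤s ℕ.z≤n))))
  ... | refl with solve-bc a b c (- 1ℤ) t l refl
  ...   | refl , refl = inj₂ (inj₂ (refl , refl , refl))

  ∣i∣≡1 : ∀ i → ∣ i ∣ ≡ 1 → Sign i
  ∣i∣≡1 (+ 1)    refl = inj₁ refl
  ∣i∣≡1 -[1+ 0 ] refl = inj₂ refl

  -- The radius 2 is attained: unit vectors along the third axis hit the centre of a window, those
  -- along the first two axes its two ends.
  unit⇒target : ∀ X P a b c A → 0ℤ ≤ X → 0ℤ ≤ A → AbsOf (K X * (a + b + c) - 1ℤ) A → UnitVector a b c →
    Target X P 1ℤ a (c - a - b) A ⊎ Target X P (- 1ℤ) a (c - a - b) A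
  unit⇒target X P a b c A 0≤X 0≤A abs unit = cases unit
    where
    rising : a + b + c ≡ 1ℤ → A ≡ K X - 1ℤ
    rising t with subst (λ h → AbsOf (K X * h - 1ℤ) A) t abs
    ... | inj₁ eq = trans eq (cong (_- 1ℤ) (*-identityʳ (K X)))
    ... | inj₂ refl = ⊥-elim (absurd {n = 4} (0≤A ⊕ 0≤+ {4} ⊗ 0≤X)
      (solve 1 (λ X → (:- ((con (+ 4) :* X :+ con (+ 6)) :* con 1ℤ :- con 1ℤ)) :+ con (+ 4) :* X := con (- + 5)) refl X))

    falling : a + b + c ≡ - 1ℤ → A ≡ K X + 1ℤ
    falling t with subst (λ h → AbsOf (K X * h - 1ℤ) A) t abs
    ... | inj₂ eq = trans eq (solve 1 (λ k → :- (k :* con (- 1ℤ) :- con 1ℤ) := k :+ con 1ℤ) refl (K X))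
    ... | inj₁ refl = ⊥-elim (absurd {n = 6} (0≤A ⊕ 0≤+ {4} ⊗ 0≤X)
      (solve 1 (λ X → ((con (+ 4) :* X :+ con (+ 6)) :* con (- 1ℤ) :- con 1ℤ) :+ con (+ 4) :* X := con (- + 7)) refl X))

    target : ∀ η d → c - a - b ≡ η → + 4 * a + A ≡ K X - η + d → - + 2 ≤ d → d ≤ + 2 → Target X P η a (c - a - b) A
    target η d refl eq -2≤d d≤2 =
      ≤-from (diff -2≤d) (trans (solve 4 (λ k m η d → d :- con (- + 2) := m :* (η :- η) :+ (k :- η :+ d) :- (k :- η :- con (+ 2))) refl (K X) (M X P) η d)
        (cong (_- (K X - η - + 2)) eq′)) ,
      ≤-from (diff d≤2) (trans (solve 4 (λ k m η d → con (+ 2) :- d := k :- η :+ con (+ 2) :- (m :* (η :- η) :+ (k :- η :+ d))) refl (K X) (M X P) η d)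
        (cong (λ h → K X - η + + 2 - h) eq′))
      where
      eq′ : M X P * (η - η) + (K X - η + d) ≡ M X P * (η - η) + + 4 * a + A
      eq′ = trans (cong (λ h → M X P * (η - η) + h) (sym eq)) (sym (+-assoc (M X P * (η - η)) (+ 4 * a) A))

    ±2 : - + 2 ≤ + 2
    ±2 = -≤+

    cases : UnitVector a b c → Target X P 1ℤ a (c - a - b) A ⊎ Target X P (- 1ℤ) a (c - a - b) A
    cases (inj₁ (a±1 , refl , refl)) with ∣i∣≡1 a a±1
    ... | inj₁ refl = inj₂ (target (- 1ℤ) (+ 2) refl
      (trans (cong (λ h → + 4 + h) (rising refl)) (solve 1 (λ k → con (+ 4) :+ (k :- con 1ℤ) := k :- con (- 1ℤ) :+ con (+ 2)) refl (K X))) ±2 ≤-refl)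
    ... | inj₂ refl = inj₁ (target 1ℤ (- + 2) refl
      (trans (cong (λ h → - + 4 + h) (falling refl)) (solve 1 (λ k → con (- + 4) :+ (k :+ con 1ℤ) := k :- con 1ℤ :+ con (- + 2)) refl (K X))) ≤-refl ±2)
    cases (inj₂ (inj₁ (refl , b±1 , refl))) with ∣i∣≡1 b b±1
    ... | inj₁ refl = inj₂ (target (- 1ℤ) (- + 2) refl
      (trans (cong (λ h → 0ℤ + h) (rising refl)) (solve 1 (λ k → con 0ℤ :+ (k :- con 1ℤ) := k :- con (- 1ℤ) :+ con (- + 2)) refl (K X))) ≤-refl ±2)
    ... | inj₂ refl = inj₁ (target 1ℤ (+ 2) refl
      (trans (cong (λ h → 0ℤ + h) (falling refl)) (solve 1 (λ k → con 0ℤ :+ (k :+ con 1ℤ) := k :- con 1ℤ :+ con (+ 2)) refl (K X))) ±2 ≤-refl)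
    cases (inj₂ (inj₂ (refl , refl , c±1))) with ∣i∣≡1 c c±1
    ... | inj₁ refl = inj₁ (target 1ℤ 0ℤ refl
      (trans (cong (λ h → 0ℤ + h) (rising refl)) (solve 1 (λ k → con 0ℤ :+ (k :- con 1ℤ) := k :- con 1ℤ :+ con 0ℤ) refl (K X))) -≤+ (+≤+ ℕ.z≤n))
    ... | inj₂ refl = inj₂ (target (- 1ℤ) 0ℤ refl
      (trans (cong (λ h → 0ℤ + h) (falling refl)) (solve 1 (λ k → con 0ℤ :+ (k :+ con 1ℤ) := k :- con (- 1ℤ) :+ con 0ℤ) refl (K X))) -≤+ (+≤+ ℕ.z≤n))

open Arithmetic

-- Grids as 2-interval-PCGs

odd : ℕ → Bool
odd zero    = false
odd (suc n) = not (odd n)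

bit : Bool → ℕ
bit false = 0
bit true  = 1

bit≤1 : ∀ b → bit b ℕ.≤ 1
bit≤1 false = z≤n
bit≤1 true  = s≤s z≤n

sign : Fin 2 → ℤ
sign 0F = 1ℤ
sign 1F = ℤ.- 1ℤ

sign-Sign : ∀ j → Sign (sign j)
sign-Sign 0F = inj₁ refl
sign-Sign 1F = inj₂ refl

∣+m-+n∣ : ∀ m n → ℤ.∣ + m ℤ.- + n ∣ ≡ ℕ.∣ m - n ∣
∣+m-+n∣ m n with ℕ.≤-total m n
... | inj₁ m≤n = trans (ℤ.∣i-j∣≡∣j-i∣ (+ m) (+ n)) (trans (cong ℤ.∣_∣ (trans (ℤ.m-n≡m⊖n n m) (ℤ.⊖-≥ m≤n)))
  (trans (sym (ℕ.m≤n⇒∣n-m∣≡n∸m m≤n)) (ℕ.∣-∣-comm n m)))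
... | inj₂ n≤m = trans (cong ℤ.∣_∣ (trans (ℤ.m-n≡m⊖n m n) (ℤ.⊖-≥ n≤m))) (sym (ℕ.m≤n⇒∣n-m∣≡n∸m n≤m))

∣∣-AbsOf : ∀ m n → AbsOf (+ m ℤ.- + n) (+ ℕ.∣ m - n ∣)
∣∣-AbsOf m n = subst (λ h → AbsOf (+ m ℤ.- + n) (+ h)) (∣+m-+n∣ m n) (abs (+ m ℤ.- + n))
  where
  abs : ∀ i → AbsOf i (+ ℤ.∣ i ∣)
  abs (+ _)      = inj₁ refl
  abs ℤ.-[1+ _ ] = inj₂ refl

-- `X`, `Y`, `Z` are the largest coordinates; `1≤top` excludes the single vertex, whose spine would
-- have no edge.
module LargeGrid (X Y Z : ℕ) (1≤top : 1 ℕ.≤ X ℕ.+ Y ℕ.+ Z) where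
  open ℤ-Solver

  G : Graph
  G = Grid (suc X) (suc Y) (suc Z)

  open Graph G using (V; Adj; finite; irrefl)

  xc yc zc : V → ℕ
  xc (x , _ , _) = toℕ x
  yc (_ , y , _) = toℕ y
  zc (_ , _ , z) = toℕ z

  top : ℕ
  top = X ℕ.+ Y ℕ.+ Z

  t : V → ℕ
  t u = xc u ℕ.+ yc u ℕ.+ zc u

  x≤X : ∀ u → xc u ℕ.≤ X
  x≤X (x , _ , _) = toℕ≤pred[n] x

  y≤Y : ∀ u → yc u ℕ.≤ Y
  y≤Y (_ , y , _) = toℕ≤pred[n] y

  z≤Z : ∀ u → zc u ℕ.≤ Z
  z≤Z (_ , _ , z) = toℕ≤pred[n] z

  t≤top : ∀ u → t u ℕ.≤ top
  t≤top u = ℕ.+-mono-≤ (ℕ.+-mono-≤ (x≤X u) (y≤Y u)) (z≤Z u)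

  k : ℕ
  k = 4 ℕ.* X ℕ.+ 6

  +k : + k ≡ K (+ X)
  +k = trans (ℤ.pos-+ (4 ℕ.* X) 6) (cong (ℤ._+ + 6) (ℤ.pos-* 4 X))

  position : ℕ → ℕ
  position n = k ℕ.* n ℕ.+ bit (odd n)

  -- The parity bit may drop by 1 from `n` to `suc n`, for which the summand `k` compensates.
  position-suc : ∀ n → position n ℕ.≤ position (suc n)
  position-suc n = begin
    k ℕ.* n ℕ.+ bit (odd n)  ≤⟨ ℕ.+-monoʳ-≤ (k ℕ.* n) (ℕ.≤-trans (bit≤1 (odd n)) 1≤k) ⟩
    k ℕ.* n ℕ.+ k            ≡⟨ ℕ.+-comm (k ℕ.* n) k ⟩
    k ℕ.+ k ℕ.* n            ≡⟨ ℕ.*-suc k n ⟨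
    k ℕ.* suc n              ≤⟨ ℕ.m≤m+n _ _ ⟩
    position (suc n)         ∎
    where
    open ℕ.≤-Reasoning
    1≤k : 1 ℕ.≤ k
    1≤k = ℕ.≤-trans (s≤s z≤n) (ℕ.m≤n+m 6 (4 ℕ.* X))

  position-mono : ∀ {m n} → m ℕ.≤ n → position m ℕ.≤ position n
  position-mono m≤n = go (ℕ.≤⇒≤′ m≤n)
    where
    go : ∀ {m n} → m ℕ.≤′ n → position m ℕ.≤ position n
    go ℕ.≤′-refl        = ℕ.≤-refl
    go (ℕ.≤′-step m≤′n) = ℕ.≤-trans (go m≤′n) (position-suc _)

  P : ℕ
  P = position top

  1≤P : 1 ℕ.≤ P
  1≤P = ℕ.≤-trans (ℕ.*-mono-≤ {1} {k} (ℕ.≤-trans (s≤s z≤n) (ℕ.m≤n+m 6 (4 ℕ.* X))) 1≤top) (ℕ.m≤m+n (k ℕ.* top) _)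

  pos<1+P : ∀ u → position (t u) ℕ.< suc P
  pos<1+P u = s≤s (position-mono (t≤top u))

  pos : V → Fin (suc P)
  pos u = fromℕ< (pos<1+P u)

  toℕ-pos : ∀ u → toℕ (pos u) ≡ position (t u)
  toℕ-pos u = toℕ-fromℕ< (pos<1+P u)

  -- `R` bounds the absolute value of `g u`, so `Co` = R + 1 keeps the odd weights positive. The gap
  -- 2 R + 2 M between `Ce` and `Co` sends even-even distances above and odd-odd distances below
  -- both windows, which lie near `Ce` + `Co` ± M + K.
  Mᶻ Kᶻ R Co Ce : ℤ
  Mᶻ = M (+ X) (+ P)
  Kᶻ = K (+ X)
  R  = Mᶻ ℤ.* (+ X ℤ.+ + Y ℤ.+ + Z) ℤ.+ + 4 ℤ.* + X
  Co = R ℤ.+ 1ℤ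
  Ce = Co ℤ.+ + 2 ℤ.* R ℤ.+ + 2 ℤ.* Mᶻ

  g : V → ℤ
  g u = Mᶻ ℤ.* (+ zc u ℤ.- + xc u ℤ.- + yc u) ℤ.+ + 4 ℤ.* + xc u

  0≤M : 0ℤ ℤ.≤ Mᶻ
  0≤M = (0≤+ {P} ⊕ 0≤+ {8} ⊗ 0≤+ {X}) ⊕ 0≤+ {10}

  0≤R+g : ∀ u → 0ℤ ℤ.≤ R ℤ.+ g u
  0≤R+g u = subst (0ℤ ℤ.≤_)
    (solve 7 (λ X Y Z M x y z →
      M :* ((X :- x) :+ ((Y :- y) :+ (Z :+ z))) :+ (con (+ 4) :* X :+ con (+ 4) :* x) :=
      M :* (X :+ Y :+ Z) :+ con (+ 4) :* X :+ (M :* (z :- x :- y) :+ con (+ 4) :* x)) refl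
      (+ X) (+ Y) (+ Z) Mᶻ (+ xc u) (+ yc u) (+ zc u))
    (0≤M ⊗ (diff (ℤ.+≤+ (x≤X u)) ⊕ diff (ℤ.+≤+ (y≤Y u)) ⊕ 0≤+ {Z} ⊕ 0≤+ {zc u}) ⊕
      0≤+ {4} ⊗ 0≤+ {X} ⊕ 0≤+ {4} ⊗ 0≤+ {xc u})

  0≤R-g : ∀ u → 0ℤ ℤ.≤ R ℤ.- g u
  0≤R-g u = subst (0ℤ ℤ.≤_)
    (solve 7 (λ X Y Z M x y z →
      M :* (X :+ (Y :+ ((Z :- z) :+ (x :+ y)))) :+ con (+ 4) :* (X :- x) :=
      M :* (X :+ Y :+ Z) :+ con (+ 4) :* X :- (M :* (z :- x :- y) :+ con (+ 4) :* x)) refl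
      (+ X) (+ Y) (+ Z) Mᶻ (+ xc u) (+ yc u) (+ zc u))
    (0≤M ⊗ (0≤+ {X} ⊕ 0≤+ {Y} ⊕ diff (ℤ.+≤+ (z≤Z u)) ⊕ 0≤+ {xc u} ⊕ 0≤+ {yc u}) ⊕
      0≤+ {4} ⊗ diff (ℤ.+≤+ (x≤X u)))

  0≤R : 0ℤ ℤ.≤ R
  0≤R = 0≤M ⊗ ((0≤+ {X} ⊕ 0≤+ {Y}) ⊕ 0≤+ {Z}) ⊕ 0≤+ {4} ⊗ 0≤+ {X}

  weightOf : Bool → ℤ → ℤ
  weightOf false h = Ce ℤ.+ h
  weightOf true  h = Co ℤ.- h

  w : V → ℤ
  w u = weightOf (odd (t u)) (g u)

  w-pos : ∀ u → 0ℤ ℤ.< w u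
  w-pos u with odd (t u)
  ... | false = <-from (0≤R+g u ⊕ 0≤+ {2} ⊗ 0≤R ⊕ 0≤+ {2} ⊗ 0≤M)
    (solve 3 (λ R M g → (R :+ g) :+ (con (+ 2) :* R :+ con (+ 2) :* M) :=
      R :+ con 1ℤ :+ con (+ 2) :* R :+ con (+ 2) :* M :+ g :- con 0ℤ :- con 1ℤ) refl R Mᶻ (g u))
  ... | true = <-from (0≤R-g u)
    (solve 2 (λ R g → R :- g := R :+ con 1ℤ :- g :- con 0ℤ :- con 1ℤ) refl R (g u))

  first last : V
  first = 0F , 0F , 0F
  last  = fromℕ X , fromℕ Y , fromℕ Z

  pos-first : toℕ (pos first) ≡ 0
  pos-first = trans (toℕ-pos first) (trans (ℕ.+-identityʳ (k ℕ.* 0)) (ℕ.*-zeroʳ k))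

  pos-last : toℕ (pos last) ≡ P
  pos-last = trans (toℕ-pos last)
    (cong position (cong₂ ℕ._+_ (cong₂ ℕ._+_ (toℕ-fromℕ X) (toℕ-fromℕ Y)) (toℕ-fromℕ Z)))

  module C = Caterpillar finite P 1≤P pos w w-pos first last pos-first pos-last

  A : V → V → ℤ
  A u v = + ℕ.∣ toℕ (pos u) - toℕ (pos v) ∣

  A≤P : ∀ u v → A u v ℤ.≤ + P
  A≤P u v = ℤ.+≤+ (ℕ.≤-trans (ℕ.∣m-n∣≤m⊔n (toℕ (pos u)) (toℕ (pos v)))
    (ℕ.⊔-lub (toℕ≤pred[n] (pos u)) (toℕ≤pred[n] (pos v))))

  centre : ℤ → ℤ
  centre s = Ce ℤ.+ Co ℤ.+ s ℤ.* Mᶻ ℤ.+ Kᶻ ℤ.- s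

  Within : ℤ → Set
  Within d = ∃[ j ] (centre (sign j) ℤ.- + 2 ℤ.≤ d × d ℤ.≤ centre (sign j) ℤ.+ + 2)

  distance : V → V → ℤ
  distance u v = w u ℤ.+ (A u v ℤ.+ w v)

  distance-by : ∀ u v {b c} → odd (t u) ≡ b → odd (t v) ≡ c →
    distance u v ≡ weightOf b (g u) ℤ.+ (A u v ℤ.+ weightOf c (g v))
  distance-by u v p q = cong₂ (λ b c → weightOf b (g u) ℤ.+ (A u v ℤ.+ weightOf c (g v))) p q

  distance-sym : ∀ u v → distance u v ≡ distance v u
  distance-sym u v = trans
    (cong (λ h → w u ℤ.+ (+ h ℤ.+ w v)) (ℕ.∣-∣-comm (toℕ (pos u)) (toℕ (pos v))))
    (solve 3 (λ a b c → a :+ (b :+ c) := c :+ (b :+ a)) refl (w u) (A v u) (w v))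

  module _ (u v : V) where
    dx dy dz : ℤ
    dx = + xc u ℤ.- + xc v
    dy = + yc u ℤ.- + yc v
    dz = + zc u ℤ.- + zc v

    adj⇒unit : Adj u v → UnitVector dx dy dz
    adj⇒unit (inj₁ (d , refl , refl))        = inj₁ (trans (∣+m-+n∣ (xc u) (xc v)) d , ℤ.+-inverseʳ (+ yc v) , ℤ.+-inverseʳ (+ zc v))
    adj⇒unit (inj₂ (inj₁ (refl , d , refl))) = inj₂ (inj₁ (ℤ.+-inverseʳ (+ xc v) , trans (∣+m-+n∣ (yc u) (yc v)) d , ℤ.+-inverseʳ (+ zc v)))
    adj⇒unit (inj₂ (inj₂ (refl , refl , d))) = inj₂ (inj₂ (ℤ.+-inverseʳ (+ xc v) , ℤ.+-inverseʳ (+ yc v) , trans (∣+m-+n∣ (zc u) (zc v)) d))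

    same : ∀ {n} {i j : Fin n} → + toℕ i ℤ.- + toℕ j ≡ 0ℤ → i ≡ j
    same {i = i} {j} eq = toℕ-injective (ℤ.+-injective (ℤ.i-j≡0⇒i≡j (+ toℕ i) (+ toℕ j) eq))

    apart : ∀ m n → ℤ.∣ + m ℤ.- + n ∣ ≡ 1 → ℕ.∣ m - n ∣ ≡ 1
    apart m n eq = trans (sym (∣+m-+n∣ m n)) eq

    unit⇒adj : UnitVector dx dy dz → Adj u v
    unit⇒adj (inj₁ (d , e , f))        = inj₁ (apart (xc u) (xc v) d , same e , same f)
    unit⇒adj (inj₂ (inj₁ (d , e , f))) = inj₂ (inj₁ (same d , apart (yc u) (yc v) e , same f))
    unit⇒adj (inj₂ (inj₂ (d , e , f))) = inj₂ (inj₂ (same d , same e , apart (zc u) (zc v) f))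

    module EvenOdd (u-even : odd (t u) ≡ false) (v-odd : odd (t v) ≡ true) where

      -- The difference of the parity bits, 0 for `u` and 1 for `v`, is the -1 inside the absolute
      -- value.
      A-AbsOf : AbsOf (K (+ X) ℤ.* (dx ℤ.+ dy ℤ.+ dz) ℤ.- 1ℤ) (A u v)
      A-AbsOf = subst (λ h → AbsOf h (A u v)) eq (∣∣-AbsOf (toℕ (pos u)) (toℕ (pos v)))
        where
        +position : ∀ s b → odd (t s) ≡ b →
          + toℕ (pos s) ≡ K (+ X) ℤ.* (+ xc s ℤ.+ + yc s ℤ.+ + zc s) ℤ.+ + bit b
        +position s b refl = trans (cong +_ (toℕ-pos s))
          (trans (ℤ.pos-+ (k ℕ.* t s) _)
            (cong (ℤ._+ + bit b) (trans (ℤ.pos-* k (t s))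
              (cong₂ ℤ._*_ +k (trans (ℤ.pos-+ (xc s ℕ.+ yc s) (zc s)) (cong (ℤ._+ + zc s) (ℤ.pos-+ (xc s) (yc s))))))))

        eq : + toℕ (pos u) ℤ.- + toℕ (pos v) ≡ K (+ X) ℤ.* (dx ℤ.+ dy ℤ.+ dz) ℤ.- 1ℤ
        eq = trans (cong₂ ℤ._-_ (+position u false u-even) (+position v true v-odd))
          (solve 7 (λ K x y z x′ y′ z′ →
            K :* (x :+ y :+ z) :+ con 0ℤ :- (K :* (x′ :+ y′ :+ z′) :+ con 1ℤ) :=
            K :* ((x :- x′) :+ (y :- y′) :+ (z :- z′)) :- con 1ℤ) refl
            (K (+ X)) (+ xc u) (+ yc u) (+ zc u) (+ xc v) (+ yc v) (+ zc v))

      offset : ℤ → ℤ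
      offset s = Mᶻ ℤ.* (dz ℤ.- dx ℤ.- dy ℤ.- s) ℤ.+ + 4 ℤ.* dx ℤ.+ A u v

      distance≡ : ∀ s → distance u v ≡ Ce ℤ.+ Co ℤ.+ s ℤ.* Mᶻ ℤ.+ offset s
      distance≡ s = trans (distance-by u v u-even v-odd)
        (solve 11 (λ s M Ce Co A x y z x′ y′ z′ →
          Ce :+ (M :* (z :- x :- y) :+ con (+ 4) :* x) :+ (A :+ (Co :- (M :* (z′ :- x′ :- y′) :+ con (+ 4) :* x′))) :=
          Ce :+ Co :+ s :* M :+ (M :* ((z :- z′) :- (x :- x′) :- (y :- y′) :- s) :+ con (+ 4) :* (x :- x′) :+ A)) refl
          s Mᶻ Ce Co (A u v) (+ xc u) (+ yc u) (+ zc u) (+ xc v) (+ yc v) (+ zc v))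

      target⇔ : ∀ s → Target (+ X) (+ P) s dx (dz ℤ.- dx ℤ.- dy) (A u v) ⇔
        (centre s ℤ.- + 2 ℤ.≤ distance u v × distance u v ℤ.≤ centre s ℤ.+ + 2)
      target⇔ s = mk⇔
        (λ (lo , hi) →
          ≤-from (diff lo) (trans (lower (offset s)) (cong (ℤ._- (centre s ℤ.- + 2)) (sym (distance≡ s)))) ,
          ≤-from (diff hi) (trans (upper (offset s)) (cong (λ h → centre s ℤ.+ + 2 ℤ.- h) (sym (distance≡ s)))))
        (λ (lo , hi) →
          ≤-from (diff lo) (trans (cong (ℤ._- (centre s ℤ.- + 2)) (distance≡ s)) (sym (lower (offset s)))) ,
          ≤-from (diff hi) (trans (cong (λ h → centre s ℤ.+ + 2 ℤ.- h) (distance≡ s)) (sym (upper (offset s)))))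
        where
        lower : ∀ o → o ℤ.- (Kᶻ ℤ.- s ℤ.- + 2) ≡ Ce ℤ.+ Co ℤ.+ s ℤ.* Mᶻ ℤ.+ o ℤ.- (centre s ℤ.- + 2)
        lower o = solve 6 (λ o K s Ce Co M → o :- (K :- s :- con (+ 2)) :=
          Ce :+ Co :+ s :* M :+ o :- (Ce :+ Co :+ s :* M :+ K :- s :- con (+ 2))) refl o Kᶻ s Ce Co Mᶻ

        upper : ∀ o → (Kᶻ ℤ.- s ℤ.+ + 2) ℤ.- o ≡ centre s ℤ.+ + 2 ℤ.- (Ce ℤ.+ Co ℤ.+ s ℤ.* Mᶻ ℤ.+ o)
        upper o = solve 6 (λ o K s Ce Co M → (K :- s :+ con (+ 2)) :- o :=
          Ce :+ Co :+ s :* M :+ K :- s :+ con (+ 2) :- (Ce :+ Co :+ s :* M :+ o)) refl o Kᶻ s Ce Co Mᶻ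

      -X≤dx : ℤ.- + X ℤ.≤ dx
      -X≤dx = ≤-from (diff (ℤ.+≤+ (x≤X v)) ⊕ 0≤+ {xc u})
        (solve 3 (λ X x x′ → (X :- x′) :+ x := x :- x′ :- (:- X)) refl (+ X) (+ xc u) (+ xc v))

      dx≤X : dx ℤ.≤ + X
      dx≤X = ≤-from (diff (ℤ.+≤+ (x≤X u)) ⊕ 0≤+ {xc v})
        (solve 3 (λ X x x′ → (X :- x) :+ x′ := X :- (x :- x′)) refl (+ X) (+ xc u) (+ xc v))

      adj⇔within : Adj u v ⇔ Within (distance u v)
      adj⇔within = mk⇔ to from
        where
        to : Adj u v → Within (distance u v)
        to e with unit⇒target (+ X) (+ P) dx dy dz (A u v) 0≤+ 0≤+ A-AbsOf (adj⇒unit e)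
        ... | inj₁ tg = 0F , Equivalence.to (target⇔ 1ℤ) tg
        ... | inj₂ tg = 1F , Equivalence.to (target⇔ (ℤ.- 1ℤ)) tg

        from : Within (distance u v) → Adj u v
        from (j , in-j) = unit⇒adj (target⇒unit (+ X) (+ P) dx dy dz (A u v) (sign j) (sign-Sign j)
          0≤+ -X≤dx dx≤X 0≤+ (A≤P u v) A-AbsOf (Equivalence.from (target⇔ (sign j)) in-j))

    even-even : odd (t u) ≡ false → odd (t v) ≡ false → Within (distance u v) → ⊥
    even-even u-even v-even (j , _ , hi) =
      let -1≤s , s≤1 = sign-bounds (sign-Sign j) in
      absurd {n = 0} (diff (subst (ℤ._≤ _) (distance-by u v u-even v-even) hi) ⊕ 0≤R+g u ⊕ 0≤R+g v ⊕ 0≤+ {ℕ.∣ toℕ (pos u) - toℕ (pos v) ∣} ⊕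
          0≤M ⊗ diff s≤1 ⊕ 0≤+ {P} ⊕ 0≤+ {4} ⊗ 0≤+ {X} ⊕ diff -1≤s)
        (solve 7 (λ X P R s gu gv A → let M = P :+ con (+ 8) :* X :+ con (+ 10) ; K = con (+ 4) :* X :+ con (+ 6)
                                          Co = R :+ con 1ℤ ; Ce = Co :+ con (+ 2) :* R :+ con (+ 2) :* M in
          (Ce :+ Co :+ s :* M :+ K :- s :+ con (+ 2) :- (Ce :+ gu :+ (A :+ (Ce :+ gv)))) :+
          ((R :+ gu) :+ ((R :+ gv) :+ (A :+ (M :* (con 1ℤ :- s) :+ (P :+ (con (+ 4) :* X :+ (s :- con (ℤ.- 1ℤ)))))))) := con (ℤ.- 1ℤ))
          refl (+ X) (+ P) R (sign j) (g u) (g v) (A u v))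

    odd-odd : odd (t u) ≡ true → odd (t v) ≡ true → Within (distance u v) → ⊥
    odd-odd u-odd v-odd (j , lo , _) =
      let -1≤s , s≤1 = sign-bounds (sign-Sign j) in
      absurd {n = 12} (diff (subst (_ ℤ.≤_) (distance-by u v u-odd v-odd) lo) ⊕ 0≤R+g u ⊕ 0≤R+g v ⊕ diff (A≤P u v) ⊕
          0≤M ⊗ diff -1≤s ⊕ 0≤+ {12} ⊗ 0≤+ {X} ⊕ diff s≤1)
        (solve 7 (λ X P R s gu gv A → let M = P :+ con (+ 8) :* X :+ con (+ 10) ; K = con (+ 4) :* X :+ con (+ 6)
                                          Co = R :+ con 1ℤ ; Ce = Co :+ con (+ 2) :* R :+ con (+ 2) :* M in
          (Co :- gu :+ (A :+ (Co :- gv)) :- (Ce :+ Co :+ s :* M :+ K :- s :- con (+ 2))) :+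
          ((R :+ gu) :+ ((R :+ gv) :+ ((P :- A) :+ (M :* (s :- con (ℤ.- 1ℤ)) :+ (con (+ 12) :* X :+ (con 1ℤ :- s)))))) := con (ℤ.- + 13))
          refl (+ X) (+ P) R (sign j) (g u) (g v) (A u v))

  module _ {u v : V} where

    t-adj : Adj u v → t v ≡ suc (t u) ⊎ t u ≡ suc (t v)
    t-adj (inj₁ (d , refl , refl)) = Sum.map
      (cong (λ h → h ℕ.+ yc v ℕ.+ zc v)) (cong (λ h → h ℕ.+ yc v ℕ.+ zc v)) (∣m-n∣≡1 (xc u) (xc v) d)
    t-adj (inj₂ (inj₁ (refl , d , refl))) = Sum.map
      (λ e → cong (ℕ._+ zc v) (trans (cong (xc v ℕ.+_) e) (ℕ.+-suc (xc v) (yc u))))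
      (λ e → cong (ℕ._+ zc v) (trans (cong (xc v ℕ.+_) e) (ℕ.+-suc (xc v) (yc v))))
      (∣m-n∣≡1 (yc u) (yc v) d)
    t-adj (inj₂ (inj₂ (refl , refl , d))) = Sum.map
      (λ e → trans (cong (xc v ℕ.+ yc v ℕ.+_) e) (ℕ.+-suc (xc v ℕ.+ yc v) (zc u)))
      (λ e → trans (cong (xc v ℕ.+ yc v ℕ.+_) e) (ℕ.+-suc (xc v ℕ.+ yc v) (zc v)))
      (∣m-n∣≡1 (zc u) (zc v) d)

    adj⇒parity : Adj u v → odd (t u) ≢ odd (t v)
    adj⇒parity e eq with t-adj e
    ... | inj₁ p = not-¬ (sym eq) (cong odd p)
    ... | inj₂ p = not-¬ eq (cong odd p)

  adj⇔within : ∀ u v → Adj u v ⇔ Within (distance u v)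
  adj⇔within u v = by-parity _ _ refl refl
    where
    by-parity : ∀ b c → odd (t u) ≡ b → odd (t v) ≡ c → Adj u v ⇔ Within (distance u v)
    by-parity false true  p q = EvenOdd.adj⇔within u v p q
    by-parity true  false p q = mk⇔
      (λ e → subst Within (distance-sym v u) (Equivalence.to (EvenOdd.adj⇔within v u q p) (Graph.symm G {u} {v} e)))
      (λ h → Graph.symm G {v} {u} (Equivalence.from (EvenOdd.adj⇔within v u q p) (subst Within (distance-sym u v) h)))
    by-parity false false p q = mk⇔
      (λ e → ⊥-elim (adj⇒parity {u} {v} e (trans p (sym q)))) (λ h → ⊥-elim (even-even u v p q h))
    by-parity true  true  p q = mk⇔
      (λ e → ⊥-elim (adj⇒parity {u} {v} e (trans p (sym q)))) (λ h → ⊥-elim (odd-odd u v p q h))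

  interval : Fin 2 → ClosedInterval
  interval j = record
    { lo    = constant (centre (sign j) ℤ.- + 2)
    ; hi    = constant (centre (sign j) ℤ.+ + 2)
    ; lo≤hi = ≐-≤ {constant (centre (sign j) ℤ.- + 2)} {constant (centre (sign j) ℤ.+ + 2)} (λ _ → refl) (λ _ → refl)
        (≤-from (0≤+ {4}) (solve 1 (λ c → con (+ 4) := c :+ con (+ 2) :- (c :- con (+ 2))) refl (centre (sign j))))
    }

  open WeightedTree C.tree using (dist)

  ∈ᴵ⇔ : ∀ {r i} → r ≐ i → ∀ j → r ∈ᴵ interval j ⇔ (centre (sign j) ℤ.- + 2 ℤ.≤ i × i ℤ.≤ centre (sign j) ℤ.+ + 2)
  ∈ᴵ⇔ {r} r≐i j = mk⇔
    (λ (p , q) → ≐-≤⁻ {constant (centre (sign j) ℤ.- + 2)} {r} (λ _ → refl) r≐i p ,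
      ≐-≤⁻ {r} {constant (centre (sign j) ℤ.+ + 2)} r≐i (λ _ → refl) q)
    (λ (p , q) → ≐-≤ {constant (centre (sign j) ℤ.- + 2)} {r} (λ _ → refl) r≐i p ,
      ≐-≤ {r} {constant (centre (sign j) ℤ.+ + 2)} r≐i (λ _ → refl) q)

  separated : centre (ℤ.- 1ℤ) ℤ.+ + 2 ℤ.< centre 1ℤ ℤ.- + 2
  separated = <-from (0≤+ {2} ⊗ 0≤+ {P} ⊕ 0≤+ {16} ⊗ 0≤+ {X} ⊕ 0≤+ {13})
    (solve 4 (λ B K X P → let M = P :+ con (+ 8) :* X :+ con (+ 10) in
      con (+ 2) :* P :+ (con (+ 16) :* X :+ con (+ 13)) :=
      (B :+ con 1ℤ :* M :+ K :- con 1ℤ :- con (+ 2)) :- (B :+ con (ℤ.- 1ℤ) :* M :+ K :- con (ℤ.- 1ℤ) :+ con (+ 2)) :- con 1ℤ)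
      refl (Ce ℤ.+ Co) Kᶻ (+ X) (+ P))

  intervals-disjoint : Disjoint (interval 1F) (interval 0F)
  intervals-disjoint (r , (_ , r≤hi) , (lo≤r , _)) = lo≤r
    (≤ᴿ-<-trans {r} {constant (centre (ℤ.- 1ℤ) ℤ.+ + 2)} {constant (centre 1ℤ ℤ.- + 2)} r≤hi
      (≐-< {constant (centre (ℤ.- 1ℤ) ℤ.+ + 2)} {constant (centre 1ℤ ℤ.- + 2)} (λ _ → refl) (λ _ → refl) separated))

  isIntervalPCG : IsIntervalPCG 2 G
  isIntervalPCG = record
    { tree        = C.tree
    ; ζ           = inj₂
    ; ζ-injective = inj₂-injective
    ; ζ-image     = C.leaf⇔
    ; interval    = interval
    ; disjoint    = λ { {0F} {0F} i≢i _ → i≢i refl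
                      ; {0F} {1F} _ (r , p , q) → intervals-disjoint (r , q , p)
                      ; {1F} {0F} _ → intervals-disjoint
                      ; {1F} {1F} i≢i _ → i≢i refl }
    ; adj⇔        = λ {u} {v} u≢v → mk⇔
        (λ e → let j , h = Equivalence.to (adj⇔within u v) e in
          j , Equivalence.from (∈ᴵ⇔ {dist (inj₂ u) (inj₂ v)} (C.dist-≐ u≢v) j) h)
        (λ (j , h) → Equivalence.from (adj⇔within u v) (j , Equivalence.to (∈ᴵ⇔ {dist (inj₂ u) (inj₂ v)} (C.dist-≐ u≢v) j) h))
    }

-- The one-vertex grid

singleton : Graph
singleton = record
  { V        = Fin 1
  ; order    = 1
  ; finite   = ↔-id _
  ; nonEmpty = 0F
  ; Adj      = λ _ _ → ⊥
  ; adj?     = λ _ _ → no λ ()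
  ; symm     = λ ()
  ; irrefl   = λ _ ()
  }

singletonTree : WeightedTree
singletonTree = record
  { graph      = singleton
  ; connected  = λ { 0F 0F → path ε ([] ∷ []) }
  ; acyclic    = λ _ _ ()
  ; weight     = λ _ _ → 0ᴿ
  ; weight-sym = λ ()
  ; weight-pos = λ ()
  }

point : ℤ → ClosedInterval
point i = record { lo = constant i ; hi = constant i ; lo≤hi = proj₁ (≃ᴿ-refl {constant i}) }

point-disjoint : ∀ {i j} → i ℤ.< j → Disjoint (point i) (point j)
point-disjoint {i} {j} i<j (r , (_ , r≤i) , (j≤r , _)) = j≤r
  (≤ᴿ-<-trans {r} {constant i} {constant j} r≤i (≐-< {constant i} {constant j} (λ _ → refl) (λ _ → refl) i<j))

-- There are no pairs to separate, so any two disjoint intervals do, here the points 1 and -1; the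
-- sole tree vertex is a leaf by the convention for one-vertex trees.
singleVertex : IsIntervalPCG 2 (Grid 1 1 1)
singleVertex = record
  { tree        = singletonTree
  ; ζ           = λ _ → 0F
  ; ζ-injective = λ {u} {v} _ → all-equal u v
  ; ζ-image     = λ { 0F → mk⇔ (λ _ → (0F , 0F , 0F) , refl) (λ _ → inj₂ λ { 0F → refl }) }
  ; interval    = λ j → point (sign j)
  ; disjoint    = λ { {0F} {0F} i≢i _ → i≢i refl
                    ; {0F} {1F} _ (r , p , q) → point-disjoint ℤ.-<+ (r , q , p)
                    ; {1F} {0F} _ → point-disjoint ℤ.-<+
                    ; {1F} {1F} i≢i _ → i≢i refl }
  ; adj⇔        = λ {u} {v} u≢v → ⊥-elim (u≢v (all-equal u v))
  }
  where
  all-equal : (u v : GridVertex 1 1 1) → u ≡ v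
  all-equal (0F , 0F , 0F) (0F , 0F , 0F) = refl

grid-2-interval-PCG : ∀ n₁ n₂ n₃ .{{_ : NonZero n₁}} .{{_ : NonZero n₂}} .{{_ : NonZero n₃}} →
  IsIntervalPCG 2 (Grid n₁ n₂ n₃)
grid-2-interval-PCG 1 1 1 = singleVertex
grid-2-interval-PCG 1 1 (suc (suc z)) = LargeGrid.isIntervalPCG 0 0 (suc z) (s≤s z≤n)
grid-2-interval-PCG 1 (suc (suc y)) (suc z) = LargeGrid.isIntervalPCG 0 (suc y) z (s≤s z≤n)
grid-2-interval-PCG (suc (suc x)) (suc y) (suc z) = LargeGrid.isIntervalPCG (suc x) y z (s≤s z≤n)

open import Data.Nat.Base using (_≤_)

corollary5p3 : IsMinimum
    (λ k → 1 ≤ k ×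
    (∀ (n₁ n₂ n₃ : ℕ) .{{_ : NonZero n₁}} .{{_ : NonZero n₂}} .{{_ : NonZero n₃}} →
    IsIntervalPCG k (Grid n₁ n₂ n₃)))
    2
corollary5p3 = (s≤s z≤n , grid-2-interval-PCG) , λ
  { 0             (() , _)
  ; 1             (_ , PCG) → ⊥-elim (cube-not-PCG (PCG 3 3 3))
  ; (suc (suc _)) _         → s≤s (s≤s z≤n)
  }
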